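{- For every connected graph $G$ on $n$ vertices, the $\varphi$-quotient embedding algorithm with repair loop (described in the context), run with dimension cap $k_{\max}=n-1$, terminates and returns an isometric embedding of $G$ into $\mathrm{Cay}(\mathbb{Z}_2^k,S)$ with $k\leq n-1$.
   Context: Graphs are finite, simple, connected and undirected; $d_G$ is the shortest-path distance; an embedding $\lambda:V(G)\to\mathbb{Z}_2^k$ with generator set $S$ is isometric if $d_{\mathrm{Cay}}(\lambda(u),\lambda(v))=d_G(u,v)$ for all $u,v$, where $\mathrm{Cay}(\mathbb{Z}_2^k,S)$ is the graph on $\mathbb{Z}_2^k$ with edges $\{g,g+s\}$, $s\in S$. Quotient labeling of a partition. Given a partition $\mathcal{P}=\{F_1,\dots,F_t\}$ of $E(G)$, let $A[i,j]=|F_j\cap E(B_i)|\bmod 2$ for a cycle basis $B_1,\dots,B_c$ of $G$ (basis of the cycle space over $\mathbb{F}_2$), put $k=t-\mathrm{rank}_{\mathbb{F}_2}(A)$, let $g_j\in\mathbb{Z}_2^k$ be the image of the $j$-th standard basis vector under $\mathbb{Z}_2^t\to\mathbb{Z}_2^t/\mathrm{rowspan}(A)\cong\mathbb{Z}_2^k$, and let $\lambda(v)$ be the sum of the $g_j$ of the classes of the edges along any path from a fixed root to $v$. Algorithm. Initial partition: edges $\{u,v\},\{x,y\}$ are $\varphi$-related if $d(u,x)=d(v,y)$ and $d(u,y)=d(v,x)$; form the graph $\varphi(G)$ on $E(G)$ joining distinct $\varphi$-related edges; obtain $\mathcal{P}$ by repeatedly taking a largest connected component of the remaining graph, adding the whole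 component as a class if it is a clique and otherwise adding a maximum (or greedily found) clique of it as a class, and deleting the class. Then loop: (1) compute the quotient labeling $(k,\lambda,\{g_j\})$ of $\mathcal{P}$ and $S=\{g_j:g_j\neq\mathbf 0\}$; (2) if $k>k_{\max}$, return the quotient labeling of the all-singleton partition (the naive embedding, of dimension $n-1$); (3) compute $d_{\mathrm{Cay}}(\mathbf{0},\cdot)$ by breadth-first search truncated at depth $\mathrm{diam}(G)$, and the set $\mathcal{V}$ of pairs $(u,v)$ with $d_{\mathrm{Cay}}(\lambda(u),\lambda(v))\neq d_G(u,v)$; (4) if $\mathcal{V}=\emptyset$, return $(\lambda,k,S)$; (5) otherwise pick $(u^*,v^*)\in\mathcal{V}$ maximizing $d_G-d_{\mathrm{Cay}}$, take a geodesic word of generators summing to $\lambda(u^*)+\lambda(v^*)$, choose a largest class with at least two edges among the classes whose generators occur in that word (if none exists, a largest class with at least two edges), move one edge of it into a new singleton class, and repeat. -}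

module Defs where

open import Algebra.Morphism.Definitions using (Homomorphic₂)
open import Data.Bool using (Bool; false; _∧_; _∨_; _xor_)
open import Data.Fin as Fin using (Fin; zero; suc)
open import Data.Fin.Subset
open import Data.Integer as ℤ using (_⊖_)
open import Data.List as List using (List; []; _∷_)
import Data.List.Membership.Propositional as List∈
open import Data.List.Relation.Unary.All using (All)
open import Data.Maybe using (Maybe; just; nothing)
open import Data.Nat using (ℕ; zero; suc; _∸_; _≤_; _<_; _≡ᵇ_; _%_; NonZero)
open import Data.Product using (Σ; ∃-syntax; _×_; _,_; proj₁; proj₂)
open import Data.Sum using (_⊎_)
open import Data.Vec as Vec using (Vec; []; _∷_)
open import Function.Bundles using (_⇔_)
open import Function.Definitions using (Injective; StrictlySurjective)
open import Level using (0ℓ)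
open import Relation.Binary.Core using (Rel)
open import Relation.Binary.Construct.Closure.ReflexiveTransitive
  using (Star; ε; _◅_; fold)
open import Relation.Binary.PropositionalEquality using (_≡_; _≢_; refl)
open import Relation.Nullary using (¬_; does)
open import Relation.Unary using (Pred)

len : {A : Set} {R : Rel A 0ℓ} {u v : A} → Star R u v → ℕ
len {A} = fold {I = A} (λ _ _ → ℕ) (λ _ l → suc l) 0

IsDist : {A : Set} → Rel A 0ℓ → A → A → ℕ → Set
IsDist R u v d = (∃[ w ] len {R = R} {u} {v} w ≡ d) ×
                 ((w : Star R u v) → d ≤ len w)

-- Finite simple undirected graphs.  The edges are the 2-element sets
-- {proj₁ (ends e) , proj₂ (ends e)}, numbered by Fin m; `ordered`
-- excludes loops, and with `ends-injective` it excludes multiple edges.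
record Graph (n : ℕ) : Set where
  field
    m              : ℕ
    ends           : Fin m → Fin n × Fin n
    ordered        : ∀ e → proj₁ (ends e) Fin.< proj₂ (ends e)
    ends-injective : Injective _≡_ _≡_ ends

  Joins : Fin m → Rel (Fin n) 0ℓ
  Joins e u v = ends e ≡ (u , v) ⊎ ends e ≡ (v , u)

  Adj : Rel (Fin n) 0ℓ
  Adj u v = ∃[ e ] Joins e u v

  incident : Fin n → Subset m
  incident v = Vec.tabulate λ e →
    does (v Fin.≟ proj₁ (ends e)) ∨ does (v Fin.≟ proj₂ (ends e))

  CycleSpace : Pred (Subset m) 0ℓ
  CycleSpace X = ∀ v → ∣ X ∩ incident v ∣ % 2 ≡ 0

Connected : ∀ {n} → Graph n → Set
Connected {n} G = NonZero n × (∀ u v → Star (Graph.Adj G) u v)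

IsDiameter : ∀ {n} → Graph n → ℕ → Set
IsDiameter G D = (∀ u v d → IsDist (Graph.Adj G) u v d → d ≤ D) ×
                 (∃[ u ] ∃[ v ] IsDist (Graph.Adj G) u v D)

-- 𝔽₂ is (Bool, _xor_, _∧_).  Subset k is Vec Bool k,
-- so a set is identified with its characteristic vector and ⁅ j ⁆ is the
-- j-th standard basis vector.

ℤ₂^_ : ℕ → Set
ℤ₂^ k = Vec Bool k

infixl 6 _⊕_

_⊕_ : ∀ {k} → ℤ₂^ k → ℤ₂^ k → ℤ₂^ k
_⊕_ = Vec.zipWith _xor_

𝟎 : ∀ {k} → ℤ₂^ k
𝟎 = Vec.replicate _ false

lincomb : ∀ {c k} → ℤ₂^ c → Vec (ℤ₂^ k) c → ℤ₂^ k
lincomb []       []       = 𝟎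
lincomb (a ∷ as) (x ∷ xs) = Vec.map (a ∧_) x ⊕ lincomb as xs

Span : ∀ {c k} → Vec (ℤ₂^ k) c → Pred (ℤ₂^ k) 0ℓ
Span xs y = ∃[ as ] lincomb as xs ≡ y

IsBasis : ∀ {c k} → Vec (ℤ₂^ k) c → Pred (ℤ₂^ k) 0ℓ → Set
IsBasis xs W = (∀ as → lincomb as xs ≡ 𝟎 → as ≡ 𝟎) ×
               (∀ y → Span xs y ⇔ W y)

-- A matrix is the vector of its rows; its rank is the dimension of the
-- row span.
HasRank : ∀ {c k} → Vec (ℤ₂^ k) c → ℕ → Set
HasRank {k = k} A r = Σ (Vec (ℤ₂^ k) r) λ ρ → IsBasis ρ (Span A)

Cay : ∀ {k} → Pred (ℤ₂^ k) 0ℓ → Rel (ℤ₂^ k) 0ℓ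
Cay S g h = ∃[ s ] S s × h ≡ g ⊕ s

IsometricEmbedding : ∀ {n k} → Graph n → (Fin n → ℤ₂^ k) →
                     Pred (ℤ₂^ k) 0ℓ → Set
IsometricEmbedding G label S =
  ∀ u v → ∃[ d ] IsDist (Graph.Adj G) u v d ×
                 IsDist (Cay S) (label u) (label v) d

record Partition (m t : ℕ) : Set where
  field
    cls        : Fin m → Fin t
    surjective : StrictlySurjective _≡_ cls

  block : Fin t → Subset m
  block j = Vec.tabulate λ e → does (cls e Fin.≟ j)

  blocks : List (Subset m)
  blocks = List.tabulate block

open Partition

singletons : ∀ m → Partition m m
singletons m = record { cls = λ e → e ; surjective = λ e → e , refl }

-- P′ is P with e moved into a new class, numbered zero; the old classes
-- are shifted up by one.
Splits : ∀ {m t} → Fin m → Partition m t → Partition m (suc t) → Set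
Splits e P P′ = cls P′ e ≡ zero × (∀ f → f ≢ e → cls P′ f ≡ suc (cls P f))

LargestAmong : ∀ {m} → Pred (Subset m) 0ℓ → Pred (Subset m) 0ℓ
LargestAmong Q X = Q X × (∀ Y → Q Y → ∣ Y ∣ ≤ ∣ X ∣)

-- The quotient labeling of a partition, relative to a root.  All choices
-- (cycle basis, identification of the quotient with ℤ₂^k) are left open.
module _ {n} (G : Graph n) (root : Fin n) where
  open Graph G

  pathSum : ∀ {k} → (Fin m → ℤ₂^ k) → ∀ {u v} → Star Adj u v → ℤ₂^ k
  pathSum γ ε             = 𝟎
  pathSum γ ((e , _) ◅ w) = γ e ⊕ pathSum γ w

  record QuotientLabeling {t} (P : Partition m t) : Set where
    field
      {c}      : ℕ
      basis    : Vec (Subset m) c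
      isBasis  : IsBasis basis CycleSpace

    A : Vec (ℤ₂^ t) c
    A = Vec.map (λ B → Vec.tabulate λ j → (∣ block P j ∩ B ∣ % 2) ≡ᵇ 1) basis

    field
      {rank}   : ℕ
      hasRank  : HasRank A rank

    k : ℕ
    k = t ∸ rank

    -- π is the projection ℤ₂^t → ℤ₂^t / rowspan A ≅ ℤ₂^k.
    field
      π        : ℤ₂^ t → ℤ₂^ k
      π-hom    : Homomorphic₂ (ℤ₂^ t) (ℤ₂^ k) _≡_ π _⊕_ _⊕_
      π-onto   : StrictlySurjective _≡_ π
      π-kernel : ∀ x → π x ≡ 𝟎 ⇔ Span A x

    gen : Fin t → ℤ₂^ k
    gen j = π ⁅ j ⁆

    field
      label    : Fin n → ℤ₂^ k
      label-≡  : ∀ v (w : Star Adj root v) →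
                 label v ≡ pathSum (λ e → gen (cls P e)) w

    S : Pred (ℤ₂^ k) 0ℓ
    S s = s ≢ 𝟎 × (∃[ j ] gen j ≡ s)

module Phi {n} (G : Graph n) where
  open Graph G

  SameDist : Fin n → Fin n → Fin n → Fin n → Set
  SameDist u v x y = ∃[ d ] IsDist Adj u v d × IsDist Adj x y d

  -- The two conditions are exchanged when the endpoints of one edge are
  -- swapped, so the orientation given by `ends` is immaterial.
  φRelated : Rel (Fin m) 0ℓ
  φRelated e f = let (u , v) = ends e ; (x , y) = ends f in
    SameDist u x v y × SameDist u y v x

  φAdj : Rel (Fin m) 0ℓ
  φAdj e f = e ≢ f × φRelated e f

  Induced : Subset m → Rel (Fin m) 0ℓ
  Induced R e f = e ∈ R × f ∈ R × φAdj e f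

  IsComponent : Subset m → Pred (Subset m) 0ℓ
  IsComponent R C =
    ∃[ e ] e ∈ R × (∀ f → f ∈ C ⇔ Star (Induced R) e f)

  IsClique : Pred (Subset m) 0ℓ
  IsClique K = ∀ e f → e ∈ K → f ∈ K → e ≢ f → φAdj e f

  MaximumClique : Subset m → Pred (Subset m) 0ℓ
  MaximumClique C = LargestAmong (λ K → K ⊆ C × IsClique K)

  Extends : Subset m → Subset m → Pred (Fin m) 0ℓ
  Extends C K e = e ∈ C × e ∉ K × (∀ f → f ∈ K → φAdj e f)

  -- Grows C K K′: adding elements of C to the clique K one at a time, as
  -- long as some element is adjacent to all those present, can end in K′.
  data Grows (C : Subset m) : Rel (Subset m) 0ℓ where
    stop : ∀ {K} → (∀ e → ¬ Extends C K e) → Grows C K K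
    add  : ∀ {K K′} e → Extends C K e → Grows C (K ∪ ⁅ e ⁆) K′ →
           Grows C K K′

  GreedyClique : Subset m → Pred (Subset m) 0ℓ
  GreedyClique C = Grows C ⊥

data CliqueRule : Set where
  maximum greedy : CliqueRule

-- Breadth-first search from 𝟎 in Cay S, truncated at depth D.
data TruncatedDist {k} (S : Pred (ℤ₂^ k) 0ℓ) (D : ℕ) (x : ℤ₂^ k) :
                   Maybe ℕ → Set where
  within : ∀ {d} → IsDist (Cay S) 𝟎 x d → d ≤ D → TruncatedDist S D x (just d)
  beyond : (∀ d → IsDist (Cay S) 𝟎 x d → ¬ d ≤ D) → TruncatedDist S D x nothing

-- `rule` decides, for each component that is not a clique, whether a maximum
-- clique or a greedily found one is taken.
module Algorithm {n} (G : Graph n) (kmax : ℕ) (root : Fin n)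
                 (rule : Subset (Graph.m G) → CliqueRule) where
  open Graph G
  open Phi G

  ChosenClique : CliqueRule → Subset m → Pred (Subset m) 0ℓ
  ChosenClique maximum = MaximumClique
  ChosenClique greedy  = GreedyClique

  NextClass : Subset m → Pred (Subset m) 0ℓ
  NextClass C K = (IsClique C × K ≡ C) ⊎
                  (¬ IsClique C × ChosenClique (rule C) C K)

  -- One pass through the repair loop, given a quotient labeling Q of P and
  -- the table τ of distances from 𝟎 produced by the search.
  module Repair {t} {P : Partition m t} (Q : QuotientLabeling G root P)
                (τ : ℤ₂^ (QuotientLabeling.k Q) → Maybe ℕ) where
    open QuotientLabeling Q

    Violated : Rel (Fin n) 0ℓ
    Violated u v = ∃[ d ] IsDist Adj u v d × τ (label u ⊕ label v) ≢ just d

    Gap : Fin n → Fin n → ℕ → ℕ → Set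
    Gap u v d c = IsDist Adj u v d × τ (label u ⊕ label v) ≡ just c

    -- Pairs beyond the truncation depth have d_Cay treated as infinite, so
    -- they do not compete for the maximal gap d_G − d_Cay.
    WorstPair : Fin n → Fin n → ℕ → ℕ → Set
    WorstPair u v d c =
      Violated u v × Gap u v d c ×
      (∀ u′ v′ d′ c′ → Violated u′ v′ → Gap u′ v′ d′ c′ →
        (d′ ⊖ c′) ℤ.≤ (d ⊖ c))

    GeodesicWord : ℤ₂^ k → ℕ → Pred (List (ℤ₂^ k)) 0ℓ
    GeodesicWord x c w =
      All S w × List.foldr _⊕_ 𝟎 w ≡ x × List.length w ≡ c

    Splittable : Pred (Subset m) 0ℓ
    Splittable F = (∃[ j ] block P j ≡ F) × 2 ≤ ∣ F ∣

    SplittableIn : List (ℤ₂^ k) → Pred (Subset m) 0ℓ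
    SplittableIn w F =
      ∃[ j ] block P j ≡ F × 2 ≤ ∣ F ∣ × gen j List∈.∈ w

    ChosenClass : List (ℤ₂^ k) → Pred (Subset m) 0ℓ
    ChosenClass w F =
      LargestAmong (SplittableIn w) F ⊎
      ((∀ F′ → ¬ SplittableIn w F′) × LargestAmong Splittable F)

  -- The algorithm is a transition system in which every choice left open is
  -- nondeterministic.
  data State : Set₁ where
    -- remaining edges, classes found so far
    building  : Subset m → List (Subset m) → State
    repairing : ∀ {t} → Partition m t → State
    returned  : ∀ {k} → (Fin n → ℤ₂^ k) → Pred (ℤ₂^ k) 0ℓ → State

  output : ∀ {t} {P : Partition m t} → QuotientLabeling G root P → State
  output Q = returned (QuotientLabeling.label Q) (QuotientLabeling.S Q)

  initial : State
  initial = building ⊤ []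

  infix 4 _⟶_

  data _⟶_ : State → State → Set₁ where
    take   : ∀ {R Fs C K} →
             LargestAmong (IsComponent R) C → NextClass C K →
             building R Fs ⟶ building (R ─ K) (K ∷ Fs)

    start  : ∀ {R Fs t} {P : Partition m t} →
             Empty R → blocks P ≡ Fs →
             building R Fs ⟶ repairing P

    cap    : ∀ {t} {P : Partition m t} (Q : QuotientLabeling G root P) →
             kmax < QuotientLabeling.k Q →
             (naive : QuotientLabeling G root (singletons m)) →
             repairing P ⟶ output naive

    accept : ∀ {t D} {P : Partition m t} (Q : QuotientLabeling G root P)
             {τ : ℤ₂^ (QuotientLabeling.k Q) → Maybe ℕ} →
             QuotientLabeling.k Q ≤ kmax →
             IsDiameter G D →
             (∀ x → TruncatedDist (QuotientLabeling.S Q) D x (τ x)) →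
             (∀ u v → ¬ Repair.Violated Q τ u v) →
             repairing P ⟶ output Q

    repair : ∀ {t D} {P : Partition m t} {P′ : Partition m (suc t)}
             (Q : QuotientLabeling G root P)
             {τ : ℤ₂^ (QuotientLabeling.k Q) → Maybe ℕ} →
             let open QuotientLabeling Q using (k; S; label)
                 open Repair Q τ
             in
             k ≤ kmax →
             IsDiameter G D →
             (∀ x → TruncatedDist S D x (τ x)) →
             ∀ {u v d c w F e} →
             WorstPair u v d c →
             GeodesicWord (label u ⊕ label v) c w →
             ChosenClass w F →
             e ∈ F →
             Splits e P P′ →
             repairing P ⟶ repairing P′

  -- TerminatesWith Post s: every run from s is finite, never gets stuck, and
  -- ends by returning an output satisfying Post.
  data TerminatesWith (Post : ∀ {k} → (Fin n → ℤ₂^ k) → Pred (ℤ₂^ k) 0ℓ → Set)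
                      : State → Set₁ where
    done : ∀ {k} {label : Fin n → ℤ₂^ k} {S : Pred (ℤ₂^ k) 0ℓ} →
           Post label S → TerminatesWith Post (returned label S)
    next : ∀ {s} → (∃[ s′ ] s ⟶ s′) →
           (∀ s′ → s ⟶ s′ → TerminatesWith Post s′) →
           TerminatesWith Post s

{-# OPTIONS --safe #-}

-- Every repair step adds a class, and a partition of the m edges has at most
-- m classes, so the loop is finite.  It cannot get stuck: labels of adjacent
-- vertices differ by 𝟎 or a generator, so d_Cay ≤ d_G ≤ diam G and all the
-- distances needed lie within the truncation depth.  If no class can be split
-- any more, then every class is a singleton, rowspan A is the cycle space,
-- and the labeling is isometric: a word of l generators representing
-- λ(u) + λ(v) is a sum of l edges with boundary u + v, which contains a path
-- from u to v.  Hence a violated pair always leaves a class to split.  The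
-- naive embedding has dimension at most n − 1 because its target
-- ℤ₂^m / (cycle space) embeds, via the boundary map, into the even subsets
-- of the vertices.
module Submission where

open import Defs
open import Algebra.Bundles using (AbelianGroup; CommutativeRing)
open import Algebra.Morphism.Definitions using (Homomorphic₂)
import Algebra.Properties.AbelianGroup as AbelianGroupProperties
import Algebra.Properties.CommutativeSemigroup as CommutativeSemigroupProperties
open import Data.Bool as Bool using (Bool; true; false; not; _∧_; _∨_; _xor_)
open import Data.Bool.Properties
  using (xor-assoc; xor-comm; xor-identity; xor-identityʳ; xor-same; ∧-distribˡ-xor;
         ∧-distribʳ-xor; ∧-zeroʳ; ∧-identityʳ; xor-∧-commutativeRing)
open import Data.Empty using (⊥-elim)
open import Data.Fin as Fin using (Fin; zero; suc)
open import Data.Fin.Properties as Fin using (2↔Bool; *↔×; any?; all?; punchIn-punchOut)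
open import Data.Fin.Subset
open import Data.Fin.Subset.Induction using (⊃-wellFounded; ⊂-wellFounded; Acc; acc)
open import Data.Fin.Subset.Properties
import Data.Integer as ℤ
import Data.Integer.Properties as ℤ
open import Data.List as List using (List; []; _∷_)
import Data.List.Membership.DecPropositional as DecMembership
import Data.List.Properties as List
open import Data.List.Relation.Unary.All using (All; []; _∷_)
open import Data.Maybe using (Maybe; just; nothing)
import Data.Maybe.Properties as Maybe
open import Data.Nat
  using (ℕ; zero; suc; _+_; _∸_; _^_; _⊔_; _≤_; _<_; _≤?_; _≡ᵇ_; _%_; s≤s; z≤n)
import Data.Nat.Properties as ℕ
open import Data.Product using (∃; ∃-syntax; _×_; _,_; proj₁; proj₂)
open import Data.Product.Function.NonDependent.Propositional using (_×-↔_)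
open import Data.Product.Properties using () renaming (≡-dec to ×-≡-dec)
open import Data.Sum using (inj₁; inj₂)
open import Data.Unit using (tt) renaming (⊤ to Unit)
open import Data.Vec as Vec using (Vec; []; _∷_; there; lookup; tabulate)
import Data.Vec.Properties as Vec
open import Function using (_∘_; id)
open import Function.Bundles using (_⇔_; mk⇔; Equivalence; _↔_; mk↔ₛ′; Inverse)
open import Function.Construct.Composition using (_↔-∘_)
open import Function.Definitions using (Injective; StrictlySurjective)
open import Level using (0ℓ)
open import Relation.Binary.Construct.Closure.ReflexiveTransitive
  using (Star; ε; _◅_; _◅◅_)
open import Relation.Binary.Core using (Rel)
open import Relation.Binary.Definitions
  using () renaming (Decidable to Decidable₂; DecidableEquality to DecEq)
open import Relation.Binary.PropositionalEquality
open import Relation.Nullary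
open import Relation.Nullary.Decidable
  using (map′; does-⇔; dec-true; dec-false; decidable-stable; _×-dec_; _⊎-dec_; _→-dec_; ¬?)
open import Relation.Unary using (Pred; Decidable)
open ≡-Reasoning

-- Every choice of the algorithm is nondeterministic, so each state carries two obligations of
-- different kinds. To show that some step exists, all ingredients must be produced effectively:
-- labelings by Gaussian elimination; distances, components, cliques and extremal classes by
-- exhaustive search. This is why so much decidability is established. To control all steps, nothing
-- may be assumed about the choices: the cycle basis, the rank and the identification of the
-- quotient with ℤ₂^k are whatever the step supplies. Hence the metric facts and the dimension bound
-- are derived for an arbitrary `QuotientLabeling` from its fields, not for the constructed one. The
-- bound is obtained by counting elements, which avoids comparing ranks of different bases. The
-- search table starts at 𝟎 whereas isometry concerns pairs; words in the generators mediate,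
-- because in characteristic 2 the difference of two labels is their sum.

private variable
  a b c k n t : ℕ
  A : Set

-- Elementary abelian 2-groups

⊕-abelianGroup : ℕ → AbelianGroup 0ℓ 0ℓ
⊕-abelianGroup k = record
  { Carrier = ℤ₂^ k ; _≈_ = _≡_ ; _∙_ = _⊕_ ; ε = 𝟎 ; _⁻¹ = id
  ; isAbelianGroup = record
    { isGroup = record
      { isMonoid = record
        { isSemigroup = record
          { isMagma = record { isEquivalence = isEquivalence ; ∙-cong = cong₂ _⊕_ }
          ; assoc = Vec.zipWith-assoc xor-assoc }
        ; identity = Vec.zipWith-identityˡ (proj₁ xor-identity) ,
                     Vec.zipWith-identityʳ (proj₂ xor-identity) }
      ; inverse = self , self
      ; ⁻¹-cong = id }
    ; comm = Vec.zipWith-comm xor-comm } }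
  where
  self : ∀ {k} (x : ℤ₂^ k) → x ⊕ x ≡ 𝟎
  self []      = refl
  self (b ∷ x) = cong₂ _∷_ (xor-same b) (self x)

module _ {k : ℕ} where
  open AbelianGroup (⊕-abelianGroup k) public
    using ()
    renaming (assoc to ⊕-assoc; comm to ⊕-comm; identityˡ to ⊕-identityˡ;
              identityʳ to ⊕-identityʳ; inverseˡ to ⊕-self)
  open AbelianGroupProperties (⊕-abelianGroup k) public
    using ()
    renaming (\\-leftDividesˡ to ⊕-cancel; x∙y⁻¹≈ε⇒x≈y to ⊕≡𝟎⇒≡;
              identityˡ-unique to ⊕-identityˡ-unique)
  open CommutativeSemigroupProperties
    (AbelianGroup.commutativeSemigroup (⊕-abelianGroup k)) public
    using ()
    renaming (interchange to ⊕-interchange; x∙yz≈y∙xz to x⊕yz≡y⊕xz)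

  ⊕-telescope : (x y z : ℤ₂^ k) → (x ⊕ y) ⊕ (y ⊕ z) ≡ x ⊕ z
  ⊕-telescope x y z = trans (⊕-assoc x y (y ⊕ z)) (cong (x ⊕_) (⊕-cancel y z))

lookup-ext : {A : Set} {x y : Vec A k} → (∀ i → lookup x i ≡ lookup y i) → x ≡ y
lookup-ext {x = x} {y} h = begin
  x                    ≡⟨ Vec.tabulate∘lookup x ⟨
  tabulate (lookup x)  ≡⟨ Vec.tabulate-cong h ⟩
  tabulate (lookup y)  ≡⟨ Vec.tabulate∘lookup y ⟩
  y                    ∎

lookup-⁅⁆ : (i j : Fin k) → lookup ⁅ i ⁆ j ≡ does (i Fin.≟ j)
lookup-⁅⁆ zero    zero    = refl
lookup-⁅⁆ zero    (suc j) = Vec.lookup-replicate j false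
lookup-⁅⁆ (suc i) zero    = refl
lookup-⁅⁆ (suc i) (suc j) = lookup-⁅⁆ i j

does-≟-sym : (i j : Fin k) → does (i Fin.≟ j) ≡ does (j Fin.≟ i)
does-≟-sym i j = does-⇔ (mk⇔ sym sym) (i Fin.≟ j) (j Fin.≟ i)

-- Homomorphisms of elementary abelian 2-groups

Hom : (ℤ₂^ a → ℤ₂^ b) → Set
Hom {a} {b} h = Homomorphic₂ (ℤ₂^ a) (ℤ₂^ b) _≡_ h _⊕_ _⊕_

module _ {h : ℤ₂^ a → ℤ₂^ b} (hom : Hom h) where

  hom-𝟎 : h 𝟎 ≡ 𝟎
  hom-𝟎 = ⊕-identityˡ-unique (h 𝟎) (h 𝟎)
    (trans (sym (hom 𝟎 𝟎)) (cong h (⊕-identityˡ 𝟎)))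

  hom-≡⇒ : ∀ {x y} → h x ≡ h y → h (x ⊕ y) ≡ 𝟎
  hom-≡⇒ {x} {y} eq = trans (hom x y) (trans (cong (_⊕ h y) eq) (⊕-self (h y)))

  hom-≡⇐ : ∀ {x y} → h (x ⊕ y) ≡ 𝟎 → h x ≡ h y
  hom-≡⇐ {x} {y} eq = ⊕≡𝟎⇒≡ (h x) (h y) (trans (sym (hom x y)) eq)

  hom-lincomb : (as : ℤ₂^ c) (xs : Vec (ℤ₂^ a) c) →
                h (lincomb as xs) ≡ lincomb as (Vec.map h xs)
  hom-lincomb []       []       = hom-𝟎
  hom-lincomb (α ∷ as) (x ∷ xs) =
    trans (hom _ _) (cong₂ _⊕_ (scale α) (hom-lincomb as xs))
    where
    scale : ∀ α → h (Vec.map (α ∧_) x) ≡ Vec.map (α ∧_) (h x)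
    scale true  = trans (cong h (Vec.map-id x)) (sym (Vec.map-id (h x)))
    scale false = trans (cong h (Vec.map-const x false))
                        (trans hom-𝟎 (sym (Vec.map-const (h x) false)))

-- Induction on the length: the head contributes a multiple of the first basis vector, and
-- restricting to vectors with head `false` gives homomorphisms again.
hom-ext : {f g : ℤ₂^ a → ℤ₂^ b} → Hom f → Hom g →
          (∀ i → f ⁅ i ⁆ ≡ g ⁅ i ⁆) → ∀ x → f x ≡ g x
hom-ext homf homg eq [] = trans (hom-𝟎 homf) (sym (hom-𝟎 homg))
hom-ext {f = f} {g} homf homg eq (b ∷ x) = begin
  f (b ∷ x)                            ≡⟨ cong f (split b) ⟩
  f ((b ∷ 𝟎) ⊕ (false ∷ x))            ≡⟨ homf _ _ ⟩
  f (b ∷ 𝟎) ⊕ f (false ∷ x)            ≡⟨ cong₂ _⊕_ (onHead b) onTail ⟩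
  g (b ∷ 𝟎) ⊕ g (false ∷ x)            ≡⟨ homg _ _ ⟨
  g ((b ∷ 𝟎) ⊕ (false ∷ x))            ≡⟨ cong g (split b) ⟨
  g (b ∷ x)                            ∎
  where
  split : ∀ b → b ∷ x ≡ (b ∷ 𝟎) ⊕ (false ∷ x)
  split b = cong₂ _∷_ (sym (xor-identityʳ b)) (sym (⊕-identityˡ x))
  onHead : ∀ b → f (b ∷ 𝟎) ≡ g (b ∷ 𝟎)
  onHead true  = eq zero
  onHead false = trans (hom-𝟎 homf) (sym (hom-𝟎 homg))
  onTail : f (false ∷ x) ≡ g (false ∷ x)
  onTail = hom-ext (λ x y → homf (false ∷ x) (false ∷ y))
                   (λ x y → homg (false ∷ x) (false ∷ y)) (eq ∘ suc) x

-- The parity form and matrices over 𝔽₂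

parity : ℕ → Bool
parity n = (n % 2) ≡ᵇ 1

parity-suc : ∀ n → parity (suc n) ≡ not (parity n)
parity-suc zero          = refl
parity-suc (suc zero)    = refl
parity-suc (suc (suc n)) = parity-suc n

parity≡false⇒even : ∀ n → parity n ≡ false → n % 2 ≡ 0
parity≡false⇒even zero          _ = refl
parity≡false⇒even (suc zero)    ()
parity≡false⇒even (suc (suc n)) = parity≡false⇒even n

even⇒parity≡false : ∀ n → n % 2 ≡ 0 → parity n ≡ false
even⇒parity≡false n eq = cong (_≡ᵇ 1) eq

-- The standard bilinear form over 𝔽₂, written as the parity of an intersection so that the entries
-- of the class matrix unfold to its values.
dot : Subset a → Subset a → Bool
dot X Y = parity ∣ X ∩ Y ∣

dot-comm : (X Y : Subset a) → dot X Y ≡ dot Y X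
dot-comm X Y = cong (parity ∘ ∣_∣) (∩-comm X Y)

dot-∷ : ∀ α β (X Y : Subset a) → dot (α ∷ X) (β ∷ Y) ≡ (α ∧ β) xor dot X Y
dot-∷ false β     X Y = refl
dot-∷ true  false X Y = refl
dot-∷ true  true  X Y = parity-suc ∣ X ∩ Y ∣

dot-⊕ : (X Y Z : Subset a) → dot X (Y ⊕ Z) ≡ dot X Y xor dot X Z
dot-⊕ []      []      []      = refl
dot-⊕ (α ∷ X) (β ∷ Y) (γ ∷ Z) = begin
  dot (α ∷ X) ((β ∷ Y) ⊕ (γ ∷ Z))
    ≡⟨ dot-∷ α (β xor γ) X (Y ⊕ Z) ⟩
  (α ∧ (β xor γ)) xor dot X (Y ⊕ Z)
    ≡⟨ cong₂ _xor_ (∧-distribˡ-xor α β γ) (dot-⊕ X Y Z) ⟩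
  ((α ∧ β) xor (α ∧ γ)) xor (dot X Y xor dot X Z)
    ≡⟨ interchange (α ∧ β) (α ∧ γ) (dot X Y) (dot X Z) ⟩
  ((α ∧ β) xor dot X Y) xor ((α ∧ γ) xor dot X Z)
    ≡⟨ cong₂ _xor_ (dot-∷ α β X Y) (dot-∷ α γ X Z) ⟨
  dot (α ∷ X) (β ∷ Y) xor dot (α ∷ X) (γ ∷ Z) ∎
  where open CommutativeSemigroupProperties
          (CommutativeRing.+-commutativeSemigroup xor-∧-commutativeRing)

dot-⊥ : (X : Subset a) → dot X ⊥ ≡ false
dot-⊥ []      = refl
dot-⊥ (α ∷ X) = trans (dot-∷ α false X ⊥) (cong₂ _xor_ (∧-zeroʳ α) (dot-⊥ X))

dot-⁅⁆ : (X : Subset a) (i : Fin a) → dot X ⁅ i ⁆ ≡ lookup X i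
dot-⁅⁆ (α ∷ X) zero = begin
  dot (α ∷ X) ⁅ zero ⁆      ≡⟨ dot-∷ α true X ⊥ ⟩
  (α ∧ true) xor dot X ⊥    ≡⟨ cong₂ _xor_ (∧-identityʳ α) (dot-⊥ X) ⟩
  α xor false               ≡⟨ xor-identityʳ α ⟩
  α                         ∎
dot-⁅⁆ (α ∷ X) (suc i) =
  trans (dot-∷ α false X ⁅ i ⁆) (cong₂ _xor_ (∧-zeroʳ α) (dot-⁅⁆ X i))

infixr 7 _·_

_·_ : (Fin b → ℤ₂^ a) → ℤ₂^ a → ℤ₂^ b
M · x = tabulate λ i → dot (M i) x

lookup-· : (M : Fin b → ℤ₂^ a) (x : ℤ₂^ a) (i : Fin b) → lookup (M · x) i ≡ dot (M i) x
lookup-· M x = Vec.lookup∘tabulate (λ i → dot (M i) x)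

·-hom : (M : Fin b → ℤ₂^ a) → Hom (M ·_)
·-hom M x y = lookup-ext λ i → begin
  lookup (M · (x ⊕ y)) i                    ≡⟨ lookup-· M (x ⊕ y) i ⟩
  dot (M i) (x ⊕ y)                         ≡⟨ dot-⊕ (M i) x y ⟩
  dot (M i) x xor dot (M i) y               ≡⟨ cong₂ _xor_ (lookup-· M x i) (lookup-· M y i) ⟨
  lookup (M · x) i xor lookup (M · y) i     ≡⟨ Vec.lookup-zipWith _xor_ i (M · x) (M · y) ⟨
  lookup (M · x ⊕ M · y) i                  ∎

lookup-·⁅⁆ : (M : Fin b → ℤ₂^ a) (e : Fin a) (i : Fin b) →
             lookup (M · ⁅ e ⁆) i ≡ lookup (M i) e
lookup-·⁅⁆ M e i = trans (lookup-· M ⁅ e ⁆ i) (dot-⁅⁆ (M i) e)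

-- Subspaces and their quotients

_≟ᵥ_ : (x y : ℤ₂^ k) → Dec (x ≡ y)
_≟ᵥ_ = Vec.≡-dec Bool._≟_

-- Scalar multiples are automatic over 𝔽₂. Decidable membership lets the elimination below decide
-- whether a coordinate has a pivot.
record IsSubspace (W : Pred (ℤ₂^ k) 0ℓ) : Set where
  field
    has-𝟎  : W 𝟎
    has-⊕  : ∀ {x y} → W x → W y → W (x ⊕ y)
    member : Decidable W

map-∧-distribʳ-⊕ : ∀ α β (x : ℤ₂^ k) →
                   Vec.map ((α xor β) ∧_) x ≡ Vec.map (α ∧_) x ⊕ Vec.map (β ∧_) x
map-∧-distribʳ-⊕ α β []      = refl
map-∧-distribʳ-⊕ α β (γ ∷ x) = cong₂ _∷_ (∧-distribʳ-xor γ α β) (map-∧-distribʳ-⊕ α β x)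

lincomb-⊕ : (as bs : ℤ₂^ c) (xs : Vec (ℤ₂^ k) c) →
            lincomb (as ⊕ bs) xs ≡ lincomb as xs ⊕ lincomb bs xs
lincomb-⊕ []       []       []       = sym (⊕-identityˡ 𝟎)
lincomb-⊕ (α ∷ as) (β ∷ bs) (x ∷ xs) =
  trans (cong₂ _⊕_ (map-∧-distribʳ-⊕ α β x) (lincomb-⊕ as bs xs)) (⊕-interchange _ _ _ _)

lincomb-hom : (xs : Vec (ℤ₂^ k) c) → Hom (λ as → lincomb as xs)
lincomb-hom xs as bs = lincomb-⊕ as bs xs

span-isSubspace : (xs : Vec (ℤ₂^ k) c) → IsSubspace (Span xs)
span-isSubspace xs = record
  { has-𝟎  = 𝟎 , hom-𝟎 (lincomb-hom xs)
  ; has-⊕  = λ { (as , refl) (bs , refl) → as ⊕ bs , lincomb-⊕ as bs xs }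
  ; member = λ y → anySubset? (λ as → lincomb as xs ≟ᵥ y)
  }

-- One elimination yields both a basis of W and the projection modulo W. Applied to a row span, this
-- makes the rank and the dimension of the quotient fit together through `dim+codim`.
record Quotient (W : Pred (ℤ₂^ a) 0ℓ) : Set where
  field
    {dim codim} : ℕ
    dim+codim   : dim + codim ≡ a
    basis       : Vec (ℤ₂^ a) dim
    isBasis     : IsBasis basis W
    π           : ℤ₂^ a → ℤ₂^ codim
    π-hom       : Hom π
    π-onto      : StrictlySurjective _≡_ π
    π-kernel    : ∀ x → π x ≡ 𝟎 ⇔ W x

lincomb-shift : (as : ℤ₂^ c) (xs : Vec (ℤ₂^ k) c) →
                lincomb as (Vec.map (false ∷_) xs) ≡ false ∷ lincomb as xs
lincomb-shift as xs = sym (hom-lincomb (λ _ _ → refl) as xs)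

module _ {W : Pred (ℤ₂^ suc k) 0ℓ} (sub : IsSubspace W)
         (Q : Quotient (W ∘ (false ∷_))) where
  open IsSubspace sub
  open Quotient Q
  open Equivalence

  private
    independent = proj₁ isBasis
    spans       = proj₂ isBasis

  -- Every vector of W starts with `false`, so the leading coordinate survives in the quotient and
  -- raises the codimension by one.
  quotient-flat : ¬ (∃[ y ] W (true ∷ y)) → Quotient W
  quotient-flat ∄ = record
    { dim+codim = trans (ℕ.+-suc dim codim) (cong suc dim+codim)
    ; basis     = Vec.map (false ∷_) basis
    ; isBasis   =
        (λ as eq → independent as (Vec.∷-injectiveʳ (trans (sym (lincomb-shift as basis)) eq))) ,
        (λ y → mk⇔ (λ { (as , refl) → subst W (sym (lincomb-shift as basis))
                                        (to (spans _) (as , refl)) })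
                   (from-W y))
    ; π         = λ { (α ∷ x) → α ∷ π x }
    ; π-hom     = λ { (α ∷ x) (β ∷ y) → cong (_ ∷_) (π-hom x y) }
    ; π-onto    = λ { (α ∷ y) → let x , eq = π-onto y in (α ∷ x) , cong (α ∷_) eq }
    ; π-kernel  = λ { (α ∷ x) → mk⇔ (kernel⇒ α x) (kernel⇐ α x) }
    }
    where
    from-W : ∀ y → W y → Span (Vec.map (false ∷_) basis) y
    from-W (true  ∷ y) Wy = contradiction (y , Wy) ∄
    from-W (false ∷ y) Wy =
      let as , eq = from (spans y) Wy in as , trans (lincomb-shift as basis) (cong (false ∷_) eq)
    kernel⇒ : ∀ α x → α ∷ π x ≡ 𝟎 → W (α ∷ x)
    kernel⇒ false x eq = to (π-kernel x) (Vec.∷-injectiveʳ eq)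
    kernel⇒ true  x ()
    kernel⇐ : ∀ α x → W (α ∷ x) → α ∷ π x ≡ 𝟎
    kernel⇐ false x Wx = cong (false ∷_) (from (π-kernel x) Wx)
    kernel⇐ true  x Wx = contradiction (x , Wx) ∄

  -- The pivot clears the leading coordinate of any vector without changing its class modulo W. So
  -- the quotient is that of the vectors of W starting with `false`, and the pivot raises the
  -- dimension by one.
  quotient-pivot : (y₀ : ℤ₂^ k) → W (true ∷ y₀) → Quotient W
  quotient-pivot y₀ Wy₀ = record
    { dim+codim = cong suc dim+codim
    ; basis     = basis⁺
    ; isBasis   = indep⁺ , λ y → mk⇔ (λ { (α ∷ as , refl) → span⇒W α as }) (W⇒span y)
    ; π         = λ x → π (reduce x)
    ; π-hom     = λ x y → trans (cong π (reduce-hom x y)) (π-hom _ _)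
    ; π-onto    = λ y → let x , eq = π-onto y in
                    (false ∷ x) , trans (cong π (reduce-false x)) eq
    ; π-kernel  = λ x → mk⇔ (λ eq → unreduce x (to (π-kernel _) eq))
                            (λ Wx → from (π-kernel _) (W-reduce x Wx))
    }
    where
    basis⁺ = (true ∷ y₀) ∷ Vec.map (false ∷_) basis

    -- Adds the pivot scaled by the leading coordinate; the result starts with `false`, and that
    -- entry is dropped.
    reduce : ℤ₂^ suc k → ℤ₂^ k
    reduce (α ∷ x) = x ⊕ Vec.map (α ∧_) y₀

    reduce-hom : Hom reduce
    reduce-hom (α ∷ x) (β ∷ y) =
      trans (cong ((x ⊕ y) ⊕_) (map-∧-distribʳ-⊕ α β y₀)) (⊕-interchange x y _ _)

    reduce-false : ∀ x → reduce (false ∷ x) ≡ x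
    reduce-false x = trans (cong (x ⊕_) (Vec.map-const y₀ false)) (⊕-identityʳ x)

    W-multiple : ∀ α → W (α ∷ Vec.map (α ∧_) y₀)
    W-multiple true  = subst (λ y → W (true ∷ y)) (sym (Vec.map-id y₀)) Wy₀
    W-multiple false = subst (λ y → W (false ∷ y)) (sym (Vec.map-const y₀ false)) has-𝟎

    W-reduce : ∀ x → W x → W (false ∷ reduce x)
    W-reduce (α ∷ x) Wx =
      subst (λ β → W (β ∷ reduce (α ∷ x))) (xor-same α) (has-⊕ Wx (W-multiple α))

    unreduce : ∀ x → W (false ∷ reduce x) → W x
    unreduce (α ∷ x) Wr = subst W (cong (α ∷_) x≡) (has-⊕ Wr (W-multiple α))
      where
      x≡ : reduce (α ∷ x) ⊕ Vec.map (α ∧_) y₀ ≡ x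
      x≡ = trans (⊕-assoc x _ _) (trans (cong (x ⊕_) (⊕-self _)) (⊕-identityʳ x))

    lincomb⁺ : ∀ α as → lincomb (α ∷ as) basis⁺ ≡ α ∷ (Vec.map (α ∧_) y₀ ⊕ lincomb as basis)
    lincomb⁺ α as = trans (cong (Vec.map (α ∧_) (true ∷ y₀) ⊕_) (lincomb-shift as basis))
      (cong (_∷ (Vec.map (α ∧_) y₀ ⊕ lincomb as basis)) (trans (xor-identityʳ (α ∧ true)) (∧-identityʳ α)))

    indep⁺ : ∀ as → lincomb as basis⁺ ≡ 𝟎 → as ≡ 𝟎
    -- By `lincomb⁺` the leading coordinate of the combination is the coefficient of the pivot, so a
    -- vanishing combination cannot use the pivot.
    indep⁺ (true  ∷ as) eq with () ← trans (sym (lincomb⁺ true as)) eq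
    indep⁺ (false ∷ as) eq = cong (false ∷_) (independent as (begin
      lincomb as basis                              ≡⟨ ⊕-identityˡ _ ⟨
      𝟎 ⊕ lincomb as basis                          ≡⟨ cong (_⊕ _) (Vec.map-const y₀ false) ⟨
      Vec.map (false ∧_) y₀ ⊕ lincomb as basis      ≡⟨ Vec.∷-injectiveʳ (trans (sym (lincomb⁺ false as)) eq) ⟩
      𝟎                                             ∎))

    span⇒W : ∀ α as → W (lincomb (α ∷ as) basis⁺)
    span⇒W α as = subst W
      (sym (trans (lincomb⁺ α as)
        (cong (_∷ (Vec.map (α ∧_) y₀ ⊕ lincomb as basis)) (sym (xor-identityʳ α)))))
      (has-⊕ (W-multiple α) (to (spans _) (as , refl)))

    W⇒span : ∀ y → W y → Span basis⁺ y
    W⇒span (α ∷ x) Wx = let as , eq = from (spans _) (W-reduce (α ∷ x) Wx) in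
      α ∷ as , trans (lincomb⁺ α as) (cong (α ∷_)
        (trans (cong (_ ⊕_) eq) (trans (⊕-comm _ _) (trans (⊕-assoc x _ _)
          (trans (cong (x ⊕_) (⊕-self _)) (⊕-identityʳ x))))))

subspace-tail : {W : Pred (ℤ₂^ suc k) 0ℓ} → IsSubspace W → IsSubspace (W ∘ (false ∷_))
subspace-tail sub = record { has-𝟎 = has-𝟎 ; has-⊕ = has-⊕ ; member = λ x → member (false ∷ x) }
  where open IsSubspace sub

-- Gaussian elimination, one coordinate at a time; pivots are found by trying all tails.
quotient : ∀ {a} {W : Pred (ℤ₂^ a) 0ℓ} → IsSubspace W → Quotient W
quotient {zero} {W} sub = record
  { dim+codim = refl
  ; basis     = []
  ; isBasis   = (λ { [] _ → refl }) , λ { [] → mk⇔ (λ _ → has-𝟎) (λ _ → [] , refl) }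
  ; π         = id
  ; π-hom     = λ _ _ → refl
  ; π-onto    = λ y → y , refl
  ; π-kernel  = λ { [] → mk⇔ (λ _ → has-𝟎) (λ _ → refl) }
  }
  where open IsSubspace sub
quotient {suc a} {W} sub with anySubset? (λ y → IsSubspace.member sub (true ∷ y))
... | yes (y₀ , Wy₀) = quotient-pivot sub (quotient (subspace-tail sub)) y₀ Wy₀
... | no ∄           = quotient-flat sub (quotient (subspace-tail sub)) ∄

-- Dimension and cardinality

Fin[2^k]↔ℤ₂^k : ∀ k → Fin (2 ^ k) ↔ ℤ₂^ k
Fin[2^k]↔ℤ₂^k zero    = mk↔ₛ′ (λ _ → []) (λ _ → zero) (λ { [] → refl }) (λ { zero → refl })
Fin[2^k]↔ℤ₂^k (suc k) =
  mk↔ₛ′ (λ (α , x) → α ∷ x) Vec.uncons (λ { (_ ∷ _) → refl }) (λ _ → refl)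
  ↔-∘ ((2↔Bool ×-↔ Fin[2^k]↔ℤ₂^k k) ↔-∘ *↔×)

-- There are 2^a elements to be placed among 2^b. Counting makes this applicable to a map defined
-- through chosen preimages.
injective⇒dim≤ : {f : ℤ₂^ a → ℤ₂^ b} → Injective _≡_ _≡_ f → a ≤ b
injective⇒dim≤ {a} {b} {f} inj = ℕ.≮⇒≥ λ b<a →
  ℕ.<⇒≱ (ℕ.^-monoʳ-< 2 (s≤s (s≤s z≤n)) b<a) (Fin.injective⇒≤ f′-inj)
  where
  module A = Inverse (Fin[2^k]↔ℤ₂^k a)
  module B = Inverse (Fin[2^k]↔ℤ₂^k b)
  f′-inj : Injective _≡_ _≡_ (B.from ∘ f ∘ A.to)
  f′-inj {i} {j} eq = begin
    i                ≡⟨ A.strictlyInverseʳ i ⟨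
    A.from (A.to i)  ≡⟨ cong A.from (inj (trans (sym (B.strictlyInverseˡ _))
                          (trans (cong B.to eq) (B.strictlyInverseˡ _)))) ⟩
    A.from (A.to j)  ≡⟨ A.strictlyInverseʳ j ⟩
    j                ∎

-- Exhaustive search and extremal elements

Search : Set → Set₁
Search A = ∀ {P : Pred A 0ℓ} → Decidable P → Dec (∃ P)

search× : Search A → Search (A × A)
search× search P? = map′ (λ (x , y , p) → (x , y) , p) (λ ((x , y) , p) → x , y , p)
  (search λ x → search λ y → P? (x , y))

least : {P : Pred ℕ 0ℓ} → Decidable P → ∀ n → P n → ∃[ d ] P d × (∀ d′ → P d′ → d ≤ d′)
least P? zero    p = 0 , p , λ _ _ → z≤n
least {P} P? (suc n) p with P? 0
... | yes p₀ = 0 , p₀ , λ _ _ → z≤n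
... | no ¬p₀ with d , q , min ← least (P? ∘ suc) n p = suc d , q , λ
  { zero     p₀ → contradiction p₀ ¬p₀
  ; (suc d′) p′ → s≤s (min d′ p′) }

-- The bound M is lowered until an element attains it; an inhabitant of Q stops the descent at 0 at
-- the latest.
maximal : Search A → {Q : Pred A 0ℓ} → Decidable Q → (f : A → ℕ) →
          ∀ M → (∀ x → Q x → f x ≤ M) → ∃ Q → ∃[ x ] Q x × (∀ y → Q y → f y ≤ f x)
maximal search Q? f M f≤M ∃Q with search (λ x → Q? x ×-dec (f x ℕ.≟ M))
... | yes (x , q , refl) = x , q , f≤M
maximal search Q? f zero    f≤M (x , q) | no ∄ = ⊥-elim (∄ (x , q , ℕ.n≤0⇒n≡0 (f≤M x q)))
maximal search Q? f (suc M) f≤M ∃Q      | no ∄ =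
  maximal search Q? f M (λ x q → ℕ.≤-pred (ℕ.≤∧≢⇒< (f≤M x q) λ eq → ∄ (x , q , eq))) ∃Q

bounded : ∀ {n} (f : Fin n → ℕ) → ∃[ M ] (∀ i → f i ≤ M)
bounded {zero}  f = 0 , λ ()
bounded {suc n} f with M , f≤M ← bounded (f ∘ suc) = f zero ⊔ M , λ
  { zero    → ℕ.m≤m⊔n (f zero) M
  ; (suc i) → ℕ.≤-trans (f≤M i) (ℕ.m≤n⊔m (f zero) M) }

-- Distances in finite graphs

IsDist-unique : {R : Rel A 0ℓ} {x y : A} {d d′ : ℕ} →
                IsDist R x y d → IsDist R x y d′ → d ≡ d′
IsDist-unique ((w , refl) , min) ((w′ , refl) , min′) = ℕ.≤-antisym (min w′) (min′ w)

-- The vertex type is only asked to be searchable, so that the same construction serves G, with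
-- vertices in `Fin n`, and the Cayley graph, with vertices in ℤ₂^k.
module Distance (search : Search A) (_≟_ : DecEq A) {R : Rel A 0ℓ} (R? : Decidable₂ R) where

  Walk : A → A → ℕ → Set
  Walk x y c = ∃[ w ] len {R = R} {x} {y} w ≡ c

  walk? : ∀ c x y → Dec (Walk x y c)
  walk? zero    x y = map′ (λ { refl → ε , refl }) (λ { (ε , _) → refl ; (_ ◅ _ , ()) }) (x ≟ y)
  walk? (suc c) x y = map′
    (λ { (z , r , w , eq) → r ◅ w , cong suc eq })
    (λ { (ε , ()) ; (r ◅ w , eq) → _ , r , w , ℕ.suc-injective eq })
    (search λ z → R? x z ×-dec walk? c z y)

  shortest : ∀ {x y c} → Walk x y c → ∃[ d ] IsDist R x y d × d ≤ c
  shortest {x} {y} {c} w with d , w′ , min ← least (λ c → walk? c x y) c w =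
    d , (w′ , λ w → min (len w) (w , refl)) , min c w

-- Connected components

module _ {R : Rel (Fin n) 0ℓ} (R? : Decidable₂ R) (e : Fin n) where

  private
    -- A set of reachable points is enlarged along an edge that leaves it. Once no edge leaves, no
    -- walk from e can leave either, so the set is all that is reachable.
    grow : ∀ C → Acc _⊃_ C → e ∈ C → (∀ f → f ∈ C → Star R e f) →
           ∃[ C′ ] (∀ f → f ∈ C′ ⇔ Star R e f)
    grow C (acc rec) e∈C sound
      with any? (λ f → any? λ g → f ∈? C ×-dec ¬? (g ∈? C) ×-dec R? f g)
    ... | no closed = C , λ f → mk⇔ (sound f) (complete e∈C)
      where
      complete : ∀ {f g} → f ∈ C → Star R f g → g ∈ C
      complete f∈C ε = f∈C
      complete f∈C (_◅_ {j = g} r w) with g ∈? C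
      ... | yes g∈C = complete g∈C w
      ... | no  g∉C = ⊥-elim (closed (_ , g , f∈C , g∉C , r))
    ... | yes (f , g , f∈C , g∉C , r) =
      grow (C ∪ ⁅ g ⁆) (rec (p⊆p∪q ⁅ g ⁆ , g , x∈p∪q⁺ (inj₂ (x∈⁅x⁆ g)) , g∉C))
           (p⊆p∪q ⁅ g ⁆ e∈C) sound′
      where
      sound′ : ∀ h → h ∈ C ∪ ⁅ g ⁆ → Star R e h
      sound′ h h∈ with x∈p∪q⁻ C ⁅ g ⁆ h∈
      ... | inj₁ h∈C = sound h h∈C
      ... | inj₂ h∈g with refl ← x∈⁅y⁆⇒x≡y g h∈g = sound f f∈C ◅◅ (r ◅ ε)

  reachable : ∃[ C ] (∀ f → f ∈ C ⇔ Star R e f)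
  reachable = grow ⁅ e ⁆ (⊃-wellFounded _) (x∈⁅x⁆ e)
    λ f f∈ → subst (Star R e) (sym (x∈⁅y⁆⇒x≡y e f∈)) ε

-- Counting in subsets


∣∣≥1⇒nonempty : ∀ {X : Subset n} → 1 ≤ ∣ X ∣ → Nonempty X
∣∣≥1⇒nonempty {n} {X} 1≤ with nonempty? X
... | yes ne = ne
... | no empty with () ← subst (1 ≤_) (trans (cong ∣_∣ (Empty-unique empty)) (∣⊥∣≡0 n)) 1≤

two-elements : ∀ {X : Subset n} {e f} → e ∈ X → f ∈ X → e ≢ f → 2 ≤ ∣ X ∣
two-elements {X = X} {e} {f} e∈X f∈X e≢f =
  subst (_< ∣ X ∣) (∣⁅x⁆∣≡1 e)
    (p⊂q⇒∣p∣<∣q∣ ((λ g∈ → subst (_∈ X) (sym (x∈⁅y⁆⇒x≡y e g∈)) e∈X) ,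
      f , f∈X , λ f∈ → e≢f (sym (x∈⁅y⁆⇒x≡y e f∈))))

another-element : ∀ {X : Subset n} {e} → 2 ≤ ∣ X ∣ → ∃[ f ] f ∈ X × f ≢ e
another-element {X = X} {e} 2≤ with any? (λ f → f ∈? X ×-dec ¬? (f Fin.≟ e))
... | yes p = p
... | no ∄ = contradiction (ℕ.≤-trans 2≤ (subst (∣ X ∣ ≤_) (∣⁅x⁆∣≡1 e) (p⊆q⇒∣p∣≤∣q∣ X⊆)))
  λ { (s≤s ()) }
  where
  X⊆ : X ⊆ ⁅ e ⁆
  X⊆ {f} f∈X with f Fin.≟ e
  ... | yes refl = x∈⁅x⁆ e
  ... | no  f≢e  = ⊥-elim (∄ (f , f∈X , f≢e))

∈-block : (P : Partition b t) (j : Fin t) (e : Fin b) →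
          e ∈ Partition.block P j ⇔ Partition.cls P e ≡ j
∈-block P j e = mk⇔ to′ from′
  where
  open Partition P
  look : lookup (block j) e ≡ does (cls e Fin.≟ j)
  look = Vec.lookup∘tabulate _ e
  to′ : e ∈ block j → cls e ≡ j
  to′ e∈ with cls e Fin.≟ j | trans (sym look) (Vec.[]=⇒lookup e∈)
  ... | yes eq | _ = eq
  ... | no _ | ()
  from′ : cls e ≡ j → e ∈ block j
  from′ eq = Vec.lookup⇒[]= e (block j) (trans look (dec-true (cls e Fin.≟ j) eq))

surjective⇒≤ : {f : Fin b → Fin t} → StrictlySurjective _≡_ f → t ≤ b
surjective⇒≤ {f = f} surj = Fin.injective⇒≤ {f = proj₁ ∘ surj} λ {i} {j} eq →
  trans (sym (proj₂ (surj i))) (trans (cong f eq) (proj₂ (surj j)))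

singleton-blocks⇒injective : (P : Partition b t) →
  (∀ j → ¬ 2 ≤ ∣ Partition.block P j ∣) → Injective _≡_ _≡_ (Partition.cls P)
singleton-blocks⇒injective P small {e} {f} eq with e Fin.≟ f
... | yes e≡f = e≡f
... | no  e≢f = contradiction
  (two-elements (Equivalence.from (∈-block P _ e) eq) (Equivalence.from (∈-block P _ f) refl) e≢f)
  (small _)

-- The size hypothesis keeps the class that loses `e` inhabited, so the new class map is still
-- surjective.
split : ∀ (P : Partition b t) e → 2 ≤ ∣ Partition.block P (Partition.cls P e) ∣ →
        ∃[ P′ ] Splits e P P′
split {b} {t} P e 2≤ = record { cls = cls′ ; surjective = surj′ } , cls′-e , cls′-≢e
  where
  open Partition P
  cls′ : Fin b → Fin (suc t)
  cls′ f with f Fin.≟ e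
  ... | yes _ = zero
  ... | no  _ = suc (cls f)
  cls′-e : cls′ e ≡ zero
  cls′-e with e Fin.≟ e
  ... | yes _  = refl
  ... | no e≢e = contradiction refl e≢e
  cls′-≢e : ∀ f → f ≢ e → cls′ f ≡ suc (cls f)
  cls′-≢e f f≢e with f Fin.≟ e
  ... | yes f≡e = contradiction f≡e f≢e
  ... | no _    = refl
  surj′ : StrictlySurjective _≡_ cls′
  surj′ zero = e , cls′-e
  surj′ (suc j) with f , refl ← surjective j with f Fin.≟ e
  ... | no  f≢e  = f , cls′-≢e f f≢e
  ... | yes refl with g , g∈ , g≢e ← another-element {e = e} 2≤ =
    g , trans (cls′-≢e g g≢e) (cong suc (Equivalence.to (∈-block P _ g) g∈))

-- Words in the generators of a Cayley graph

⨁ : List (ℤ₂^ k) → ℤ₂^ k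
⨁ = List.foldr _⊕_ 𝟎

module _ {S : Pred (ℤ₂^ k) 0ℓ} where

  walk⇒word : ∀ {g h} (w : Star (Cay S) g h) →
              ∃[ ws ] All S ws × ⨁ ws ≡ g ⊕ h × List.length ws ≡ len w
  walk⇒word {g} ε = [] , [] , sym (⊕-self g) , refl
  walk⇒word {g} {h} ((s , s∈S , refl) ◅ w) with ws , all , eq , l ← walk⇒word w =
    s ∷ ws , s∈S ∷ all , shift , cong suc l
    where
    shift : s ⊕ ⨁ ws ≡ g ⊕ h
    shift = begin
      s ⊕ ⨁ ws             ≡⟨ cong (s ⊕_) eq ⟩
      s ⊕ ((g ⊕ s) ⊕ h)    ≡⟨ ⊕-assoc s (g ⊕ s) h ⟨
      (s ⊕ (g ⊕ s)) ⊕ h    ≡⟨ cong (_⊕ h) (trans (x⊕yz≡y⊕xz s g s)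
                                (trans (cong (g ⊕_) (⊕-self s)) (⊕-identityʳ g))) ⟩
      g ⊕ h                ∎

  word⇒walk : ∀ {g h} ws → All S ws → ⨁ ws ≡ g ⊕ h →
              ∃[ w ] len {R = Cay S} {g} {h} w ≡ List.length ws
  word⇒walk {g} {h} [] [] eq with refl ← ⊕≡𝟎⇒≡ g h (sym eq) = ε , refl
  word⇒walk {g} {h} (s ∷ ws) (s∈S ∷ all) eq
    with w , l ← word⇒walk {g ⊕ s} {h} ws all (begin
      ⨁ ws                ≡⟨ ⊕-cancel s (⨁ ws) ⟨
      s ⊕ (s ⊕ ⨁ ws)      ≡⟨ cong (s ⊕_) eq ⟩
      s ⊕ (g ⊕ h)         ≡⟨ ⊕-assoc s g h ⟨
      (s ⊕ g) ⊕ h         ≡⟨ cong (_⊕ h) (⊕-comm s g) ⟩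
      (g ⊕ s) ⊕ h         ∎) = (s , s∈S , refl) ◅ w , cong suc l

  -- Translation invariance of Cayley graphs: a walk is the same thing as a word, and a word only
  -- sees the sum of the two ends. This is how one search from 𝟎 measures all pairs of labels.
  translate : ∀ {g h g′ h′} → g ⊕ h ≡ g′ ⊕ h′ → (w : Star (Cay S) g h) →
              ∃[ w′ ] len {R = Cay S} {g′} {h′} w′ ≡ len w
  translate eq w with ws , all , sum , l ← walk⇒word w
    with w′ , l′ ← word⇒walk ws all (trans sum eq) = w′ , trans l′ l

  IsDist-translate : ∀ {g h g′ h′ d} → g ⊕ h ≡ g′ ⊕ h′ →
                     IsDist (Cay S) g h d → IsDist (Cay S) g′ h′ d
  IsDist-translate eq ((w , refl) , min) = translate eq w , λ w′ →
    let w″ , l = translate (sym eq) w′ in subst (len w ≤_) l (min w″)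

-- The quotient labeling

module Labeling {n} (G : Graph n) (root : Fin n) where
  open Graph G

  -- The boundary map over 𝔽₂: its rows are the vertex stars, so its kernel is the cycle space.
  ∂ : Subset m → Subset n
  ∂ = incident ·_

  ∂-hom : Hom ∂
  ∂-hom = ·-hom incident

  lookup-∂⁅⁆ : ∀ e v → lookup (∂ ⁅ e ⁆) v ≡
               does (v Fin.≟ proj₁ (ends e)) ∨ does (v Fin.≟ proj₂ (ends e))
  lookup-∂⁅⁆ e v = trans (lookup-·⁅⁆ incident e v) (Vec.lookup∘tabulate _ e)

  ∂-edge : ∀ e → ∂ ⁅ e ⁆ ≡ ⁅ proj₁ (ends e) ⁆ ⊕ ⁅ proj₂ (ends e) ⁆
  ∂-edge e = lookup-ext λ v → begin
    lookup (∂ ⁅ e ⁆) v                               ≡⟨ lookup-∂⁅⁆ e v ⟩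
    does (v Fin.≟ x) ∨ does (v Fin.≟ y)              ≡⟨ disjoint v ⟩
    does (v Fin.≟ x) xor does (v Fin.≟ y)
      ≡⟨ cong₂ _xor_ (trans (lookup-⁅⁆ x v) (does-≟-sym x v)) (trans (lookup-⁅⁆ y v) (does-≟-sym y v)) ⟨
    lookup ⁅ x ⁆ v xor lookup ⁅ y ⁆ v                ≡⟨ Vec.lookup-zipWith _xor_ v ⁅ x ⁆ ⁅ y ⁆ ⟨
    lookup (⁅ x ⁆ ⊕ ⁅ y ⁆) v                         ∎
    where
    x = proj₁ (ends e)
    y = proj₂ (ends e)
    -- An edge is not a loop, so at most one of the two tests succeeds and `∨` agrees with `xor`.
    disjoint : ∀ v → does (v Fin.≟ x) ∨ does (v Fin.≟ y) ≡ does (v Fin.≟ x) xor does (v Fin.≟ y)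
    disjoint v with v Fin.≟ x | v Fin.≟ y
    ... | yes refl | yes eq = contradiction eq (Fin.<⇒≢ (ordered e))
    ... | yes _    | no _   = refl
    ... | no _     | _      = refl

  ∂-joins : ∀ {e u v} → Joins e u v → ∂ ⁅ e ⁆ ≡ ⁅ u ⁆ ⊕ ⁅ v ⁆
  ∂-joins {e} (inj₁ refl) = ∂-edge e
  ∂-joins {e} (inj₂ refl) = trans (∂-edge e) (⊕-comm _ _)

  cycle⇒∂≡𝟎 : ∀ X → CycleSpace X → ∂ X ≡ 𝟎
  cycle⇒∂≡𝟎 X cyc = lookup-ext λ v → begin
    lookup (∂ X) v           ≡⟨ lookup-· incident X v ⟩
    dot (incident v) X       ≡⟨ dot-comm (incident v) X ⟩
    dot X (incident v)       ≡⟨ even⇒parity≡false ∣ X ∩ incident v ∣ (cyc v) ⟩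
    false                    ≡⟨ Vec.lookup-replicate v false ⟨
    lookup 𝟎 v               ∎

  ∂≡𝟎⇒cycle : ∀ X → ∂ X ≡ 𝟎 → CycleSpace X
  ∂≡𝟎⇒cycle X eq v = parity≡false⇒even ∣ X ∩ incident v ∣ (begin
    dot X (incident v)       ≡⟨ dot-comm X (incident v) ⟩
    dot (incident v) X       ≡⟨ lookup-· incident X v ⟨
    lookup (∂ X) v           ≡⟨ cong (λ z → lookup z v) eq ⟩
    lookup 𝟎 v               ≡⟨ Vec.lookup-replicate v false ⟩
    false                    ∎)

  cycleSpace-isSubspace : IsSubspace CycleSpace
  cycleSpace-isSubspace = record
    { has-𝟎  = ∂≡𝟎⇒cycle 𝟎 (hom-𝟎 ∂-hom)
    ; has-⊕  = λ {X} {Y} cycX cycY → ∂≡𝟎⇒cycle (X ⊕ Y) (trans (∂-hom X Y)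
                 (trans (cong₂ _⊕_ (cycle⇒∂≡𝟎 X cycX) (cycle⇒∂≡𝟎 Y cycY)) (⊕-identityˡ 𝟎)))
    ; member = λ X → all? λ v → ∣ X ∩ incident v ∣ % 2 ℕ.≟ 0
    }

  pathSum-cong : {γ γ′ : Fin m → ℤ₂^ k} → (∀ e → γ e ≡ γ′ e) → ∀ {u v} (w : Star Adj u v) →
                 pathSum G root γ w ≡ pathSum G root γ′ w
  pathSum-cong eq ε             = refl
  pathSum-cong eq ((e , _) ◅ w) = cong₂ _⊕_ (eq e) (pathSum-cong eq w)

  pathSum-◅◅ : (γ : Fin m → ℤ₂^ k) → ∀ {u v x} (w : Star Adj u v) (w′ : Star Adj v x) →
               pathSum G root γ (w ◅◅ w′) ≡ pathSum G root γ w ⊕ pathSum G root γ w′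
  pathSum-◅◅ γ ε             w′ = sym (⊕-identityˡ _)
  pathSum-◅◅ γ ((e , _) ◅ w) w′ =
    trans (cong (γ e ⊕_) (pathSum-◅◅ γ w w′)) (sym (⊕-assoc (γ e) _ _))

  hom-pathSum : {h : ℤ₂^ a → ℤ₂^ b} → Hom h → (γ : Fin m → ℤ₂^ a) →
                ∀ {u v} (w : Star Adj u v) →
                h (pathSum G root γ w) ≡ pathSum G root (h ∘ γ) w
  hom-pathSum homh γ ε             = hom-𝟎 homh
  hom-pathSum homh γ ((e , _) ◅ w) = trans (homh _ _) (cong (_ ⊕_) (hom-pathSum homh γ w))

  -- The edges that the walk traverses an odd number of times.
  χ : ∀ {u v} → Star Adj u v → Subset m
  χ = pathSum G root ⁅_⁆

  ∂-χ : ∀ {u v} (w : Star Adj u v) → ∂ (χ w) ≡ ⁅ u ⁆ ⊕ ⁅ v ⁆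
  ∂-χ {u} ε = trans (hom-𝟎 ∂-hom) (sym (⊕-self ⁅ u ⁆))
  ∂-χ {u} {v} (_◅_ {j = x} (e , joins) w) = begin
    ∂ (⁅ e ⁆ ⊕ χ w)                        ≡⟨ ∂-hom _ _ ⟩
    ∂ ⁅ e ⁆ ⊕ ∂ (χ w)                      ≡⟨ cong₂ _⊕_ (∂-joins joins) (∂-χ w) ⟩
    (⁅ u ⁆ ⊕ ⁅ x ⁆) ⊕ (⁅ x ⁆ ⊕ ⁅ v ⁆)      ≡⟨ ⊕-telescope ⁅ u ⁆ ⁅ x ⁆ ⁅ v ⁆ ⟩
    ⁅ u ⁆ ⊕ ⁅ v ⁆                          ∎

  module _ {t} (P : Partition m t) where
    open Partition P

    -- On a basis cycle this unfolds to the corresponding row of `A`, so `A` is by definition the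
    -- image of the cycle basis under a linear map.
    classCount : Subset m → ℤ₂^ t
    classCount = block ·_

    classCount-hom : Hom classCount
    classCount-hom = ·-hom block

    classCount-⁅⁆ : ∀ e → classCount ⁅ e ⁆ ≡ ⁅ cls e ⁆
    classCount-⁅⁆ e = lookup-ext λ j → begin
      lookup (classCount ⁅ e ⁆) j  ≡⟨ lookup-·⁅⁆ block e j ⟩
      lookup (block j) e           ≡⟨ Vec.lookup∘tabulate _ e ⟩
      does (cls e Fin.≟ j)         ≡⟨ lookup-⁅⁆ (cls e) j ⟨
      lookup ⁅ cls e ⁆ j           ∎

    cycle⇒span : {basis : Vec (Subset m) c} → IsBasis basis CycleSpace →
                 ∀ X → CycleSpace X → Span (Vec.map classCount basis) (classCount X)
    cycle⇒span isBasis X cyc with as , refl ← Equivalence.from (proj₂ isBasis X) cyc =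
      as , sym (hom-lincomb classCount-hom as _)

    labeling : Connected G → QuotientLabeling G root P
    labeling (_ , conn) = construct (trans (sym (ℕ.m+n∸m≡n dim codim)) (cong (_∸ dim) dim+codim))
                                    π π-hom π-onto π-kernel
      where
      -- Elimination is run twice: on the cycle space for the cycle basis, and on the row span for
      -- the rank and the projection.
      open Quotient (quotient cycleSpace-isSubspace)
        using () renaming (basis to cycles; isBasis to cycles-isBasis)
      rows = Vec.map classCount cycles
      open Quotient (quotient (span-isSubspace rows))
      -- `QuotientLabeling` fixes the target dimension as `t ∸ rank`. With `codim` generalised to k,
      -- matching on `refl` replaces a transport of the projection.
      construct : ∀ {k} → k ≡ t ∸ dim → (π : ℤ₂^ t → ℤ₂^ k) → Hom π →
                  StrictlySurjective _≡_ π → (∀ x → π x ≡ 𝟎 ⇔ Span rows x) →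
                  QuotientLabeling G root P
      construct refl π π-hom π-onto π-kernel = record
        { basis    = cycles
        ; isBasis  = cycles-isBasis
        ; hasRank  = basis , isBasis
        ; π        = π
        ; π-hom    = π-hom
        ; π-onto   = π-onto
        ; π-kernel = π-kernel
        ; label    = λ v → image (χ (conn root v))
        ; label-≡  = λ v w → begin
            image (χ (conn root v))                ≡⟨ path-independent (conn root v) w ⟩
            image (χ w)                            ≡⟨ hom-pathSum image-hom ⁅_⁆ w ⟩
            pathSum G root (image ∘ ⁅_⁆) w         ≡⟨ pathSum-cong (cong π ∘ classCount-⁅⁆) w ⟩
            pathSum G root (λ e → π ⁅ cls e ⁆) w   ∎
        }
        where
        image = π ∘ classCount
        image-hom : Hom image
        image-hom X Y = trans (cong π (classCount-hom X Y)) (π-hom _ _)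
        -- Two walks with the same ends have the same boundary, so they differ by a cycle, and
        -- cycles are sent into the row span.
        path-independent : ∀ {u v} (w w′ : Star Adj u v) → image (χ w) ≡ image (χ w′)
        path-independent w w′ = hom-≡⇐ image-hom (Equivalence.from (π-kernel _)
          (cycle⇒span cycles-isBasis _
            (∂≡𝟎⇒cycle _ (hom-≡⇒ ∂-hom (trans (∂-χ w) (sym (∂-χ w′)))))))

  module Properties (connected : Connected G) {t} {P : Partition m t}
                    (Q : QuotientLabeling G root P) where
    open Partition P
    open QuotientLabeling Q renaming (k to dim)
    private conn = proj₂ connected

    image : Subset m → ℤ₂^ dim
    image = π ∘ classCount P

    image-hom : Hom image
    image-hom X Y = trans (cong π (classCount-hom P X Y)) (π-hom _ _)

    image-⁅⁆ : ∀ e → image ⁅ e ⁆ ≡ gen (cls e)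
    image-⁅⁆ e = cong π (classCount-⁅⁆ P e)

    image-χ : ∀ {u v} (w : Star Adj u v) →
              image (χ w) ≡ pathSum G root (λ e → gen (cls e)) w
    image-χ w = trans (hom-pathSum image-hom ⁅_⁆ w) (pathSum-cong image-⁅⁆ w)

    cycle⇒image≡𝟎 : ∀ X → CycleSpace X → image X ≡ 𝟎
    cycle⇒image≡𝟎 X cyc = Equivalence.from (π-kernel _) (cycle⇒span P isBasis X cyc)

    -- The label of v may be computed along a path through u; the common initial part then cancels.
    label-⊕ : ∀ {u v} (w : Star Adj u v) → label u ⊕ label v ≡ image (χ w)
    label-⊕ {u} {v} w = begin
      label u ⊕ label v                     ≡⟨ cong₂ _⊕_ (label-≡ u w₀) (label-≡ v (w₀ ◅◅ w)) ⟩
      sum w₀ ⊕ sum (w₀ ◅◅ w)                ≡⟨ cong (sum w₀ ⊕_) (pathSum-◅◅ _ w₀ w) ⟩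
      sum w₀ ⊕ (sum w₀ ⊕ sum w)             ≡⟨ ⊕-cancel (sum w₀) (sum w) ⟩
      sum w                                 ≡⟨ image-χ w ⟨
      image (χ w)                           ∎
      where
      w₀ = conn root u
      sum : ∀ {u v} → Star Adj u v → ℤ₂^ dim
      sum = pathSum G root (λ e → gen (cls e))

    label-lipschitz : ∀ {u v} (w : Star Adj u v) →
                      ∃[ w′ ] len {R = Cay S} {label u} {label v} w′ ≤ len w
    label-lipschitz {u} {v} w = go w refl
      where
      -- The start g is kept apart from the label: after a nonzero step it is
      -- `label u ⊕ gen (cls e)`, equal to the next label only up to a proof. Edges whose generator
      -- is 𝟎 are skipped.
      go : ∀ {u g} (w : Star Adj u v) → g ≡ label u →
           ∃[ w′ ] len {R = Cay S} {g} {label v} w′ ≤ len w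
      go ε refl = ε , z≤n
      go {u} (_◅_ {j = x} (e , joins) w) refl
        with gen (cls e) ≟ᵥ 𝟎 | trans (label-⊕ ((e , joins) ◅ ε)) (image-χ ((e , joins) ◅ ε))
      ... | yes zero-gen | eq with w′ , w′≤ ← go {g = label u} w
              (⊕≡𝟎⇒≡ _ _ (trans eq (trans (⊕-identityʳ _) zero-gen))) =
        w′ , ℕ.m≤n⇒m≤1+n w′≤
      ... | no nonzero | eq with w′ , w′≤ ← go {g = label u ⊕ gen (cls e)} w (begin
              label u ⊕ gen (cls e)              ≡⟨ cong (label u ⊕_) (trans eq (⊕-identityʳ _)) ⟨
              label u ⊕ (label u ⊕ label x)      ≡⟨ ⊕-cancel (label u) (label x) ⟩
              label x                            ∎) =
        (gen (cls e) , (nonzero , cls e , refl) , refl) ◅ w′ , s≤s w′≤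

    S? : Decidable S
    S? s = ¬? (s ≟ᵥ 𝟎) ×-dec any? λ j → gen j ≟ᵥ s

    module _ (cls-injective : Injective _≡_ _≡_ cls) where

      block-cls : ∀ e → block (cls e) ≡ ⁅ e ⁆
      block-cls e = lookup-ext λ f → begin
        lookup (block (cls e)) f    ≡⟨ Vec.lookup∘tabulate _ f ⟩
        does (cls f Fin.≟ cls e)    ≡⟨ does-⇔ (mk⇔ (λ eq → sym (cls-injective eq)) (cong cls ∘ sym))
                                              (cls f Fin.≟ cls e) (e Fin.≟ f) ⟩
        does (e Fin.≟ f)            ≡⟨ lookup-⁅⁆ e f ⟨
        lookup ⁅ e ⁆ f              ∎

      -- The class of `e` is {e}, so its coordinate records whether `e` belongs to the set.
      classCount-injective : ∀ {X Y} → classCount P X ≡ classCount P Y → X ≡ Y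
      classCount-injective {X} {Y} eq = lookup-ext λ e →
        trans (sym (at X e)) (trans (cong (λ z → lookup z (cls e)) eq) (at Y e))
        where
        at : ∀ X e → lookup (classCount P X) (cls e) ≡ lookup X e
        at X e = begin
          lookup (classCount P X) (cls e)   ≡⟨ lookup-· block X (cls e) ⟩
          dot (block (cls e)) X             ≡⟨ cong (λ B → dot B X) (block-cls e) ⟩
          dot ⁅ e ⁆ X                       ≡⟨ dot-comm ⁅ e ⁆ X ⟩
          dot X ⁅ e ⁆                       ≡⟨ dot-⁅⁆ X e ⟩
          lookup X e                        ∎

      -- The coefficients that express the class counts of X by rows of `A` also combine the basis
      -- cycles to a cycle with the same counts; by injectivity that cycle is X.
      image≡𝟎⇒cycle : ∀ X → image X ≡ 𝟎 → CycleSpace X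
      image≡𝟎⇒cycle X eq with as , sum ← Equivalence.to (π-kernel _) eq =
        Equivalence.to (proj₂ isBasis X)
          (as , classCount-injective (trans (hom-lincomb (classCount-hom P) as basis) sum))

      word⇒edges : ∀ ws → All S ws →
                   ∃[ es ] ⨁ ws ≡ image (⨁ (List.map ⁅_⁆ es)) × List.length es ≡ List.length ws
      word⇒edges [] [] = [] , sym (hom-𝟎 {h = image} image-hom) , refl
      word⇒edges (_ ∷ ws) ((_ , j , refl) ∷ all) with es , eq , l ← word⇒edges ws all
        with e , refl ← surjective j =
        e ∷ es , trans (cong₂ _⊕_ (sym (image-⁅⁆ e)) eq) (sym (image-hom ⁅ e ⁆ (⨁ (List.map ⁅_⁆ es)))) ,
        cong suc l

  -- Walks from sums of edges

  Σ∂ : List (Fin m) → Subset n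
  Σ∂ es = ⨁ (List.map (∂ ∘ ⁅_⁆) es)

  ∂-⨁ : ∀ es → ∂ (⨁ (List.map ⁅_⁆ es)) ≡ Σ∂ es
  ∂-⨁ []       = hom-𝟎 ∂-hom
  ∂-⨁ (e ∷ es) = trans (∂-hom _ _) (cong (_ ⊕_) (∂-⨁ es))

  -- A sum over 𝔽₂ equal to `true` has a summand equal to `true`; that edge is moved to the front.
  extract : ∀ u es → lookup (Σ∂ es) u ≡ true →
            ∃[ e ] ∃[ es′ ] lookup (∂ ⁅ e ⁆) u ≡ true ×
              List.length es ≡ suc (List.length es′) × Σ∂ es ≡ ∂ ⁅ e ⁆ ⊕ Σ∂ es′
  extract u [] eq with () ← trans (sym (Vec.lookup-replicate u false)) eq
  extract u (e ∷ es) eq with lookup (∂ ⁅ e ⁆) u in eq₁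
  ... | true  = e , es , eq₁ , refl , refl
  ... | false with e′ , es′ , odd , l , sum ← extract u es (begin
            lookup (Σ∂ es) u                                   ≡⟨ cong (_xor lookup (Σ∂ es) u) eq₁ ⟨
            lookup (∂ ⁅ e ⁆) u xor lookup (Σ∂ es) u            ≡⟨ Vec.lookup-zipWith _xor_ u (∂ ⁅ e ⁆) (Σ∂ es) ⟨
            lookup (Σ∂ (e ∷ es)) u                             ≡⟨ eq ⟩
            true                                               ∎) =
    e′ , e ∷ es′ , odd , cong suc l , trans (cong (_ ⊕_) sum) (x⊕yz≡y⊕xz _ _ _)

  odd⇒joins : ∀ {e u} → lookup (∂ ⁅ e ⁆) u ≡ true → ∃[ x ] Joins e u x
  odd⇒joins {e} {u} odd
    with u Fin.≟ proj₁ (ends e) | u Fin.≟ proj₂ (ends e) | trans (sym (lookup-∂⁅⁆ e u)) odd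
  ... | yes refl | _        | _ = _ , inj₁ refl
  ... | no _     | yes refl | _ = _ , inj₂ refl
  ... | no _     | no _     | ()

  -- If u differs from v, then u is an odd vertex of the sum, so some listed edge joins it to a
  -- vertex x. Step to x: the remaining edges have boundary x + v. Edges are kept in a list with
  -- repetitions, so each step uses up exactly one letter of the word.
  edges⇒walk : ∀ l es {u v} → List.length es ≡ l → Σ∂ es ≡ ⁅ u ⁆ ⊕ ⁅ v ⁆ →
               ∃[ w ] len {R = Adj} {u} {v} w ≤ l
  edges⇒walk l es {u} {v} eq sum with u Fin.≟ v
  ... | yes refl = ε , z≤n
  ... | no u≢v with e , es′ , odd , l≡ , sum′ ← extract u es (begin
            lookup (Σ∂ es) u                       ≡⟨ cong (λ z → lookup z u) sum ⟩
            lookup (⁅ u ⁆ ⊕ ⁅ v ⁆) u               ≡⟨ Vec.lookup-zipWith _xor_ u ⁅ u ⁆ ⁅ v ⁆ ⟩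
            lookup ⁅ u ⁆ u xor lookup ⁅ v ⁆ u
              ≡⟨ cong₂ _xor_ (trans (lookup-⁅⁆ u u) (dec-true (u Fin.≟ u) refl))
                             (trans (lookup-⁅⁆ v u) (dec-false (v Fin.≟ u) (u≢v ∘ sym))) ⟩
            true                                   ∎)
    -- An edge has been extracted, so l is a successor and the recursion on it is structural.
    with l | trans (sym eq) l≡
  ... | suc l′ | l′≡ with x , joins ← odd⇒joins odd
    with w , w≤ ← edges⇒walk l′ es′ {x} {v} (sym (ℕ.suc-injective l′≡)) (begin
            Σ∂ es′                                       ≡⟨ ⊕-cancel (∂ ⁅ e ⁆) (Σ∂ es′) ⟨
            ∂ ⁅ e ⁆ ⊕ (∂ ⁅ e ⁆ ⊕ Σ∂ es′)                 ≡⟨ cong₂ _⊕_ (∂-joins joins) (trans (sym sum′) sum) ⟩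
            (⁅ u ⁆ ⊕ ⁅ x ⁆) ⊕ (⁅ u ⁆ ⊕ ⁅ v ⁆)            ≡⟨ cong (_⊕ _) (⊕-comm ⁅ u ⁆ ⁅ x ⁆) ⟩
            (⁅ x ⁆ ⊕ ⁅ u ⁆) ⊕ (⁅ u ⁆ ⊕ ⁅ v ⁆)            ≡⟨ ⊕-telescope ⁅ x ⁆ ⁅ u ⁆ ⁅ v ⁆ ⟩
            ⁅ x ⁆ ⊕ ⁅ v ⁆                                ∎) =
    (e , joins) ◅ w , s≤s w≤

  module Singleton (connected : Connected G) {t} {P : Partition m t}
                   (cls-injective : Injective _≡_ _≡_ (Partition.cls P))
                   (Q : QuotientLabeling G root P) where
    open Properties connected Q
    open QuotientLabeling Q renaming (k to dim)

    -- The edges spelling the word and a path p from u to v have the same image, so they differ by a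
    -- cycle and share the boundary u + v.
    label-expanding : ∀ {u v} (w : Star (Cay S) (label u) (label v)) →
                      ∃[ w′ ] len {R = Adj} {u} {v} w′ ≤ len w
    label-expanding {u} {v} w
      with ws , all , sum , l ← walk⇒word w
      with es , eq , l′ ← word⇒edges cls-injective ws all
      = edges⇒walk (len w) es (trans l′ l) (trans (sym (∂-⨁ es))
          (trans (hom-≡⇐ ∂-hom (cycle⇒∂≡𝟎 _ (image≡𝟎⇒cycle cls-injective _
            (hom-≡⇒ image-hom (trans (sym eq) (trans sum (label-⊕ p))))))) (∂-χ p)))
      where p = proj₂ connected u v

    IsDist-label : ∀ {u v d} → IsDist Adj u v d → IsDist (Cay S) (label u) (label v) d
    IsDist-label {d = d} ((w , refl) , min)
      with w′ , w′≤ ← label-lipschitz w = (w′ , ℕ.≤-antisym w′≤ (lower w′)) , lower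
      where
      lower : ∀ w′ → d ≤ len w′
      lower w′ with w″ , w″≤ ← label-expanding w′ = ℕ.≤-trans (min w″) w″≤

  dot-⊤⁅⁆ : (v : Fin n) → dot ⊤ ⁅ v ⁆ ≡ true
  dot-⊤⁅⁆ v = trans (dot-⁅⁆ ⊤ v) (Vec.lookup-replicate v true)

  -- The boundary of an edge set is even, so it is determined away from the root.
  ∂-even : ∀ X → dot ⊤ (∂ X) ≡ false
  ∂-even X = Vec.∷-injectiveˡ (hom-ext {f = λ X → dot ⊤ (∂ X) ∷ []} {g = λ _ → 𝟎}
    (λ X Y → cong (_∷ []) (trans (cong (dot ⊤) (∂-hom X Y)) (dot-⊕ ⊤ (∂ X) (∂ Y))))
    (λ _ _ → refl)
    (λ e → cong (_∷ []) (begin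
      dot ⊤ (∂ ⁅ e ⁆)                            ≡⟨ cong (dot ⊤) (∂-edge e) ⟩
      dot ⊤ (⁅ x e ⁆ ⊕ ⁅ y e ⁆)                  ≡⟨ dot-⊕ ⊤ ⁅ x e ⁆ ⁅ y e ⁆ ⟩
      dot ⊤ ⁅ x e ⁆ xor dot ⊤ ⁅ y e ⁆            ≡⟨ cong₂ _xor_ (dot-⊤⁅⁆ (x e)) (dot-⊤⁅⁆ (y e)) ⟩
      false                                      ∎))
    X)
    where
    x y : Fin m → Fin n
    x = proj₁ ∘ ends
    y = proj₂ ∘ ends

  -- Were the entry at the root `true`, the boundary would be {root}, which has odd size.
  ∂≡𝟎-off-root : ∀ X → (∀ v → v ≢ root → lookup (∂ X) v ≡ false) → ∂ X ≡ 𝟎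
  ∂≡𝟎-off-root X off = lookup-ext λ v → trans (at v) (sym (Vec.lookup-replicate v false))
    where
    Z = ∂ X
    Z≡⁅root⁆ : lookup Z root ≡ true → Z ≡ ⁅ root ⁆
    Z≡⁅root⁆ eq = lookup-ext λ v → trans (entry v) (sym (lookup-⁅⁆ root v))
      where
      entry : ∀ v → lookup Z v ≡ does (root Fin.≟ v)
      entry v with root Fin.≟ v
      ... | yes refl = eq
      ... | no  r≢v  = off v (r≢v ∘ sym)
    at-root : lookup Z root ≡ false
    at-root with lookup Z root in eq
    ... | false = refl
    ... | true  with () ← trans (sym (∂-even X)) (trans (cong (dot ⊤) (Z≡⁅root⁆ eq)) (dot-⊤⁅⁆ root))
    at : ∀ v → lookup Z v ≡ false
    at v with v Fin.≟ root
    ... | yes refl = at-root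
    ... | no  v≢r  = off v v≢r

-- Dimension of the naive embedding

naive-dim : ∀ {n} (G : Graph n) (root : Fin n) → Connected G →
            (Q : QuotientLabeling G root (singletons (Graph.m G))) →
            QuotientLabeling.k Q ≤ n ∸ 1
naive-dim {suc n} G root connected Q = injective⇒dim≤ {f = code} code-injective
  where
  open Graph G
  open Labeling G root
  open Properties connected Q
  open QuotientLabeling Q renaming (k to dim)

  -- The boundary of a chosen preimage with the root entry deleted, which leaves one bit per other
  -- vertex. Equal codes mean that the preimages differ by a cycle, and the projection kills cycles.
  code : ℤ₂^ dim → ℤ₂^ n
  code y = tabulate λ i → lookup (∂ (proj₁ (π-onto y))) (Fin.punchIn root i)

  image≡π : ∀ X → image X ≡ π X
  image≡π X = cong π (hom-ext (classCount-hom (singletons m)) (λ _ _ → refl)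
                              (classCount-⁅⁆ (singletons m)) X)

  code-injective : Injective _≡_ _≡_ code
  code-injective {y} {y′} eq with π-onto y | π-onto y′ | eq
  ... | X , refl | X′ , refl | eq = begin
    π X       ≡⟨ image≡π X ⟨
    image X   ≡⟨ hom-≡⇐ image-hom (cycle⇒image≡𝟎 (X ⊕ X′) (∂≡𝟎⇒cycle (X ⊕ X′)
                   (∂≡𝟎-off-root (X ⊕ X′) off))) ⟩
    image X′  ≡⟨ image≡π X′ ⟩
    π X′      ∎
    where
    off : ∀ v → v ≢ root → lookup (∂ (X ⊕ X′)) v ≡ false
    off v v≢r = begin
      lookup (∂ (X ⊕ X′)) v                   ≡⟨ cong (λ z → lookup z v) (∂-hom X X′) ⟩
      lookup (∂ X ⊕ ∂ X′) v                   ≡⟨ Vec.lookup-zipWith _xor_ v (∂ X) (∂ X′) ⟩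
      lookup (∂ X) v xor lookup (∂ X′) v      ≡⟨ cong (_xor lookup (∂ X′) v) agree ⟩
      lookup (∂ X′) v xor lookup (∂ X′) v     ≡⟨ xor-same (lookup (∂ X′) v) ⟩
      false                                   ∎
      where
      i = Fin.punchOut (v≢r ∘ sym)
      agree : lookup (∂ X) v ≡ lookup (∂ X′) v
      agree = subst (λ v → lookup (∂ X) v ≡ lookup (∂ X′) v) (punchIn-punchOut (v≢r ∘ sym)) (begin
        lookup (∂ X) (Fin.punchIn root i)     ≡⟨ Vec.lookup∘tabulate (lookup (∂ X) ∘ Fin.punchIn root) i ⟨
        lookup (tabulate (lookup (∂ X) ∘ Fin.punchIn root)) i
                                              ≡⟨ cong (λ z → lookup z i) eq ⟩
        lookup (tabulate (lookup (∂ X′) ∘ Fin.punchIn root)) i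
                                              ≡⟨ Vec.lookup∘tabulate (lookup (∂ X′) ∘ Fin.punchIn root) i ⟩
        lookup (∂ X′) (Fin.punchIn root i)    ∎)

-- Runs of the algorithm

largest : {Q : Pred (Subset a) 0ℓ} → Decidable Q → ∃ Q → ∃ (LargestAmong Q)
largest {a} Q? = maximal anySubset? Q? ∣_∣ a (λ X _ → ∣p∣≤n X)

x∈p─q⇒x∉q : ∀ (p q : Subset a) {x} → x ∈ p ─ q → x ∉ q
x∈p─q⇒x∉q (_ ∷ p) (_ ∷ q) (there x∈) (there x∈q) = x∈p─q⇒x∉q p q x∈ x∈q

module CayleyDistance {S : Pred (ℤ₂^ k) 0ℓ} (S? : Decidable S) where
  open Distance anySubset? _≟ᵥ_ {R = Cay S} (λ g h → anySubset? λ s → S? s ×-dec h ≟ᵥ (g ⊕ s)) public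

  truncatedDist : ∀ D x → ∃ (TruncatedDist S D x)
  -- The search bound is exclusive, so `suc D` admits depth D itself.
  truncatedDist D x with ℕ.anyUpTo? (λ c → walk? c 𝟎 x) (suc D)
  ... | yes (c , s≤s c≤D , w) with d , dist , d≤c ← shortest w =
    just d , within dist (ℕ.≤-trans d≤c c≤D)
  ... | no ∄ = nothing , beyond λ d dist d≤D → ∄ (d , s≤s d≤D , proj₁ dist)

  truncatedDist-just : ∀ {D x o} → TruncatedDist S D x o → ∀ {c} → Walk 𝟎 x c → c ≤ D →
                       ∃[ d ] o ≡ just d × IsDist (Cay S) 𝟎 x d × d ≤ c
  truncatedDist-just (within dist _) (w , refl) _ = _ , refl , dist , proj₂ dist w
  truncatedDist-just (beyond far) w c≤D with d , dist , d≤c ← shortest w =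
    ⊥-elim (far d dist (ℕ.≤-trans d≤c c≤D))

-- Distances, components and cliques of the input graph

module GraphDistance {n} (G : Graph n) (connected : Connected G) where
  open Graph G
  open Phi G

  Adj? : Decidable₂ Adj
  Adj? u v = any? λ e → ends e ≟ₚ (u , v) ⊎-dec ends e ≟ₚ (v , u)
    where _≟ₚ_ = ×-≡-dec Fin._≟_ Fin._≟_

  distance : ∀ u v → ∃ (IsDist Adj u v)
  distance u v with d , dist , _ ← Distance.shortest any? Fin._≟_ Adj? (proj₂ connected u v , refl) =
    d , dist

  δ : Fin n → Fin n → ℕ
  δ u v = proj₁ (distance u v)

  δ-isDist : ∀ u v → IsDist Adj u v (δ u v)
  δ-isDist u v = proj₂ (distance u v)

  δ-bounded : ∃[ M ] (∀ u v → δ u v ≤ M)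
  δ-bounded with M , row≤M ← bounded (λ u → proj₁ (bounded (δ u))) =
    M , λ u v → ℕ.≤-trans (proj₂ (bounded (δ u)) v) (row≤M u)

  diameter : Fin n → ∃ (IsDiameter G)
  diameter root
    with M , δ≤M ← δ-bounded
    with (u , v) , _ , max ← maximal (search× any?) {Q = λ _ → Unit} (λ _ → yes tt)
           (λ (u , v) → δ u v) M (λ (u , v) _ → δ≤M u v) ((root , root) , tt)
    = δ u v , (λ u′ v′ d dist → subst (_≤ δ u v) (IsDist-unique (δ-isDist u′ v′) dist) (max (u′ , v′) tt))
            , u , v , δ-isDist u v

  SameDist? : ∀ u v x y → Dec (SameDist u v x y)
  SameDist? u v x y = map′
    (λ eq → δ u v , δ-isDist u v , subst (IsDist Adj x y) (sym eq) (δ-isDist x y))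
    (λ (_ , p , q) → trans (IsDist-unique (δ-isDist u v) p) (IsDist-unique q (δ-isDist x y)))
    (δ u v ℕ.≟ δ x y)

  φAdj? : Decidable₂ φAdj
  φAdj? e f = ¬? (e Fin.≟ f) ×-dec SameDist? _ _ _ _ ×-dec SameDist? _ _ _ _

  IsClique? : Decidable IsClique
  IsClique? K = all? λ e → all? λ f →
    e ∈? K →-dec f ∈? K →-dec ¬? (e Fin.≟ f) →-dec φAdj? e f

  Extends? : ∀ C K → Decidable (Extends C K)
  Extends? C K e = e ∈? C ×-dec ¬? (e ∈? K) ×-dec all? λ f → f ∈? K →-dec φAdj? e f

  component : ∀ R e → ∃[ C ] (∀ f → f ∈ C ⇔ Star (Induced R) e f)
  component R = reachable λ e f → e ∈? R ×-dec f ∈? R ×-dec φAdj? e f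

  -- A component is determined by any of its elements, so C is compared with the computed component
  -- of each `e` in R.
  IsComponent? : ∀ R → Decidable (IsComponent R)
  IsComponent? R C = map′
    (λ { (e , e∈R , refl) → e , e∈R , proj₂ (component R e) })
    (λ (e , e∈R , char) → e , e∈R , ⊆-antisym
      (λ {f} f∈C → from (proj₂ (component R e) f) (to (char f) f∈C))
      (λ {f} f∈C → from (char f) (to (proj₂ (component R e) f) f∈C)))
    (any? λ e → e ∈? R ×-dec C ≟ᵥ proj₁ (component R e))
    where open Equivalence

  component⊆ : ∀ {R C} → IsComponent R C → C ⊆ R
  component⊆ {R} (e , e∈R , char) {f} f∈C = walk e∈R (Equivalence.to (char f) f∈C)
    where
    walk : ∀ {e} → e ∈ R → Star (Induced R) e f → f ∈ R
    walk e∈R ε                       = e∈R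
    walk _   ((_ , e∈R , _) ◅ w)     = walk e∈R w

  component-nonempty : ∀ {R C} → IsComponent R C → Nonempty C
  component-nonempty (e , _ , char) = e , Equivalence.from (char e) ε

  largestComponent : ∀ {R} → Nonempty R → ∃ (LargestAmong (IsComponent R))
  largestComponent {R} (e , e∈R) =
    largest (IsComponent? R) (proj₁ (component R e) , e , e∈R , proj₂ (component R e))

  grow : ∀ C K → Acc _⊃_ K → ∃ (Grows C K)
  grow C K (acc rec) with any? (Extends? C K)
  ... | no ∄ = K , stop λ e ext → ∄ (e , ext)
  ... | yes (e , ext@(_ , e∉K , _))
    with K′ , g ← grow C (K ∪ ⁅ e ⁆) (rec (p⊆p∪q ⁅ e ⁆ , e , x∈p∪q⁺ (inj₂ (x∈⁅x⁆ e)) , e∉K))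
    = K′ , add e ext g

  grows-⊇ : ∀ {C K K′} → Grows C K K′ → K ⊆ K′
  grows-⊇ (stop _)    x∈K = x∈K
  grows-⊇ (add e _ g) x∈K = grows-⊇ g (p⊆p∪q ⁅ e ⁆ x∈K)

  grows-⊆ : ∀ {C K K′} → Grows C K K′ → K ⊆ C → K′ ⊆ C
  grows-⊆ (stop _) K⊆C = K⊆C
  grows-⊆ {C} {K} (add e (e∈C , _) g) K⊆C = grows-⊆ g K∪e⊆C
    where
    K∪e⊆C : K ∪ ⁅ e ⁆ ⊆ C
    K∪e⊆C f∈ with x∈p∪q⁻ K ⁅ e ⁆ f∈
    ... | inj₁ f∈K = K⊆C f∈K
    ... | inj₂ f∈e with refl ← x∈⁅y⁆⇒x≡y e f∈e = e∈C

  singleton-clique : ∀ e → IsClique ⁅ e ⁆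
  singleton-clique e f g f∈ g∈ f≢g =
    contradiction (trans (x∈⁅y⁆⇒x≡y e f∈) (sym (x∈⁅y⁆⇒x≡y e g∈))) f≢g

module Runs {n} (G : Graph n) (connected : Connected G) (root : Fin n)
            (rule : Subset (Graph.m G) → CliqueRule) where
  open Graph G
  open Phi G
  open GraphDistance G connected
  open Labeling G root
  open Algorithm G (n ∸ 1) root rule
  open Partition
  open Equivalence

  -- The clique phase

  chosenClique : ∀ r C → ∃ (ChosenClique r C)
  chosenClique maximum C = largest (λ K → K ⊆? C ×-dec IsClique? K)
                                   (⊥ , ⊆-min C , λ _ _ e∈⊥ → contradiction e∈⊥ ∉⊥)
  chosenClique greedy  C = grow C ⊥ (⊃-wellFounded ⊥)

  nextClass : ∀ C → ∃ (NextClass C)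
  nextClass C with IsClique? C
  ... | yes clique = C , inj₁ (clique , refl)
  ... | no ¬clique with K , chosen ← chosenClique (rule C) C = K , inj₂ (¬clique , chosen)

  chosen-⊆ : ∀ r {C K} → ChosenClique r C K → K ⊆ C
  chosen-⊆ maximum ((K⊆C , _) , _) = K⊆C
  chosen-⊆ greedy  g               = grows-⊆ g (⊆-min _)

  -- This makes every pass remove an edge: a singleton competes with the maximum clique, and the
  -- greedy search cannot stop at the empty set while C has an element.
  chosen-nonempty : ∀ r {C K} → Nonempty C → ChosenClique r C K → Nonempty K
  chosen-nonempty maximum (e , e∈C) (_ , max) = ∣∣≥1⇒nonempty
    (subst (_≤ _) (∣⁅x⁆∣≡1 e) (max ⁅ e ⁆
      ((λ f∈ → subst (_∈ _) (sym (x∈⁅y⁆⇒x≡y e f∈)) e∈C) , singleton-clique e)))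
  chosen-nonempty greedy (e , e∈C) (stop maximal) =
    ⊥-elim (maximal e (e∈C , ∉⊥ , λ _ f∈⊥ → contradiction f∈⊥ ∉⊥))
  chosen-nonempty greedy _ (add e _ g) = e , grows-⊇ g (q⊆p∪q ⊥ ⁅ e ⁆ (x∈⁅x⁆ e))

  nextClass-⊆ : ∀ {C K} → NextClass C K → K ⊆ C
  nextClass-⊆     (inj₁ (_ , refl))   = id
  nextClass-⊆ {C} (inj₂ (_ , chosen)) = chosen-⊆ (rule C) chosen

  nextClass-nonempty : ∀ {C K} → Nonempty C → NextClass C K → Nonempty K
  nextClass-nonempty     ne (inj₁ (_ , refl))   = ne
  nextClass-nonempty {C} ne (inj₂ (_ , chosen)) = chosen-nonempty (rule C) ne chosen

  -- Loop invariant of the clique phase. Classes are addressed by their position in the list, so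
  -- `classOf` states covering and disjointness at once and turns into `cls` when R is empty.
  record PartialPartition (R : Subset m) (Fs : List (Subset m)) : Set where
    field
      untouched : ∀ e → e ∈ R → ∀ j → e ∉ List.lookup Fs j
      classOf   : ∀ e → e ∉ R → ∃[ i ] (∀ j → e ∈ List.lookup Fs j ⇔ i ≡ j)
      inhabited : ∀ j → Nonempty (List.lookup Fs j)

  partial-[] : PartialPartition ⊤ []
  partial-[] = record
    { untouched = λ _ _ () ; classOf = λ e e∉⊤ → contradiction ∈⊤ e∉⊤ ; inhabited = λ () }

  partial-∷ : ∀ {R Fs K} → K ⊆ R → Nonempty K → PartialPartition R Fs →
              PartialPartition (R ─ K) (K ∷ Fs)
  partial-∷ {R} {Fs} {K} K⊆R K-nonempty inv = record
    { untouched = λ { e e∈ zero    → x∈p─q⇒x∉q R K e∈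
                    ; e e∈ (suc j) → untouched e (p─q⊆p R K e∈) j }
    ; classOf   = classOf′
    ; inhabited = λ { zero → K-nonempty ; (suc j) → inhabited j }
    }
    where
    open PartialPartition inv
    classOf′ : ∀ e → e ∉ R ─ K → ∃[ i ] (∀ j → e ∈ List.lookup (K ∷ Fs) j ⇔ i ≡ j)
    classOf′ e e∉ with e ∈? K
    ... | yes e∈K = zero , λ
      { zero    → mk⇔ (λ _ → refl) (λ _ → e∈K)
      ; (suc j) → mk⇔ (λ e∈ → contradiction e∈ (untouched e (K⊆R e∈K) j)) (λ ()) }
    ... | no  e∉K with i , char ← classOf e (λ e∈R → e∉ (x∈p∧x∉q⇒x∈p─q e∈R e∉K)) = suc i , λ
      { zero    → mk⇔ (λ e∈K → contradiction e∈K e∉K) (λ ())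
      ; (suc j) → mk⇔ (cong suc ∘ to (char j)) (λ { refl → from (char j) refl }) }

  partial⇒partition : ∀ {R Fs} → Empty R → PartialPartition R Fs →
                      ∃[ P ] blocks {t = List.length Fs} P ≡ Fs
  partial⇒partition {R} {Fs} empty inv = P , trans (List.tabulate-cong block≡) (List.tabulate-lookup Fs)
    where
    open PartialPartition inv
    class : ∀ e → ∃[ i ] (∀ j → e ∈ List.lookup Fs j ⇔ i ≡ j)
    class e = classOf e λ e∈R → empty (e , e∈R)
    P : Partition m (List.length Fs)
    P = record
      { cls        = proj₁ ∘ class
      ; surjective = λ j → let e , e∈ = inhabited j in e , to (proj₂ (class e) j) e∈ }
    block≡ : ∀ j → block P j ≡ List.lookup Fs j
    block≡ j = ⊆-antisym (λ {e} e∈ → from (proj₂ (class e) j) (to (∈-block P j e) e∈))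
                         (λ {e} e∈ → from (∈-block P j e) (to (proj₂ (class e) j) e∈))

  -- One pass of the repair loop

  module Repairing {t} {P : Partition m t} (Q : QuotientLabeling G root P)
    {D} (isDiameter : IsDiameter G D) {τ : ℤ₂^ (QuotientLabeling.k Q) → Maybe ℕ}
    (spec : ∀ x → TruncatedDist (QuotientLabeling.S Q) D x (τ x)) where
    open QuotientLabeling Q renaming (k to dim)
    open Properties connected Q
    open Repair Q τ

    -- A shortest path from u to v maps to a Cayley walk that is no longer; translated to 𝟎, it lies
    -- within depth D. So every pair has a finite table entry and competes for the worst pair.
    dist-λ : ∀ u v → ∃[ c ] τ (label u ⊕ label v) ≡ just c ×
                            IsDist (Cay S) 𝟎 (label u ⊕ label v) c × c ≤ δ u v
    dist-λ u v =
      let (p , p≡δ) , _ = δ-isDist u v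
          w , w≤        = label-lipschitz p
          w′ , w′≡      = translate {S = S} {g′ = 𝟎} {h′ = label u ⊕ label v} (sym (⊕-identityˡ _)) w
          w′≤δ          = subst₂ _≤_ (sym w′≡) p≡δ w≤
          c , τ≡ , dist , c≤ = CayleyDistance.truncatedDist-just S? (spec (label u ⊕ label v)) (w′ , refl)
                                 (ℕ.≤-trans w′≤δ (proj₁ isDiameter u v (δ u v) (δ-isDist u v)))
      in c , τ≡ , dist , ℕ.≤-trans c≤ w′≤δ

    accepted-isometric : (∀ u v → ¬ Violated u v) → IsometricEmbedding G label S
    accepted-isometric unviolated u v =
      let c , τ≡ , dist , _ = dist-λ u v
          -- `Violated` contains an inequality, so its absence yields a doubly negated equation,
          -- which decidability makes an equation.
          τ≡δ = decidable-stable (Maybe.≡-dec ℕ._≟_ (τ (label u ⊕ label v)) (just (δ u v)))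
                  λ τ≢ → unviolated u v (δ u v , δ-isDist u v , τ≢)
          c≡δ = Maybe.just-injective (trans (sym τ≡) τ≡δ)
      in δ u v , δ-isDist u v ,
         IsDist-translate (⊕-identityˡ _) (subst (IsDist (Cay S) 𝟎 (label u ⊕ label v)) c≡δ dist)

    Violated? : Decidable₂ Violated
    Violated? u v = map′ (λ τ≢ → δ u v , δ-isDist u v , τ≢)
      (λ (d , dist , τ≢) τ≡ → τ≢ (trans τ≡ (cong just (IsDist-unique (δ-isDist u v) dist))))
      (¬? (Maybe.≡-dec ℕ._≟_ (τ (label u ⊕ label v)) (just (δ u v))))

    gap : Fin n → Fin n → ℕ
    gap u v = δ u v ∸ proj₁ (dist-λ u v)

    -- By `dist-λ` the Cayley distance never exceeds d, so the integer difference is the truncated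
    -- one and the maximum can be sought in ℕ.
    gap-⊖ : ∀ {u v d c} → Gap u v d c → d ℤ.⊖ c ≡ ℤ.+ gap u v
    gap-⊖ {u} {v} (dist , τ≡) = trans
      (cong₂ ℤ._⊖_ (IsDist-unique dist (δ-isDist u v))
                   (Maybe.just-injective (trans (sym τ≡) (proj₁ (proj₂ (dist-λ u v))))))
      (ℤ.⊖-≥ (proj₂ (proj₂ (proj₂ (dist-λ u v)))))

    widestGap : (∃[ u ] ∃[ v ] Violated u v) →
                ∃[ u ] ∃[ v ] Violated u v × (∀ u′ v′ → Violated u′ v′ → gap u′ v′ ≤ gap u v)
    widestGap (u₀ , v₀ , violated) =
      let (u , v) , viol , max = maximal (search× any?) {Q = λ (u , v) → Violated u v}
            (λ (u , v) → Violated? u v) (λ (u , v) → gap u v) D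
            (λ (u , v) _ → ℕ.≤-trans (ℕ.m∸n≤m (δ u v) (proj₁ (dist-λ u v)))
                                 (proj₁ isDiameter u v (δ u v) (δ-isDist u v)))
            ((u₀ , v₀) , violated)
      in u , v , viol , λ u′ v′ → max (u′ , v′)

    worstPair : (∃[ u ] ∃[ v ] Violated u v) →
                ∃[ u ] ∃[ v ] WorstPair u v (δ u v) (proj₁ (dist-λ u v))
    worstPair violated =
      let u , v , viol , max = widestGap violated in
      u , v , viol , gap-isGap u v , λ u′ v′ _ _ viol′ gap′ →
        subst₂ ℤ._≤_ (sym (gap-⊖ gap′)) (sym (gap-⊖ (gap-isGap u v))) (ℤ.+≤+ (max u′ v′ viol′))
      where
      gap-isGap : ∀ u v → Gap u v (δ u v) (proj₁ (dist-λ u v))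
      gap-isGap u v = δ-isDist u v , proj₁ (proj₂ (dist-λ u v))

    splittable : ∀ {u v} → Violated u v → ∃[ j ] 2 ≤ ∣ block P j ∣
    splittable {u} {v} (d , dist , τ≢) with any? (λ j → 2 ≤? ∣ block P j ∣)
    ... | yes found = found
    ... | no ∄ =
      let _ , τ≡ , dist-c , _ = dist-λ u v
          injective = singleton-blocks⇒injective P λ j 2≤ → ∄ (j , 2≤)
          dist-d = IsDist-translate (sym (⊕-identityˡ _))
                     (Singleton.IsDist-label connected injective Q dist)
      in contradiction (trans τ≡ (cong just (IsDist-unique dist-c dist-d))) τ≢

    Splittable? : Decidable Splittable
    Splittable? F = any? (λ j → block P j ≟ᵥ F) ×-dec 2 ≤? ∣ F ∣

    SplittableIn? : ∀ ws → Decidable (SplittableIn ws)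
    SplittableIn? ws F = any? λ j → block P j ≟ᵥ F ×-dec 2 ≤? ∣ F ∣ ×-dec gen j ∈ₗ? ws
      where open DecMembership (_≟ᵥ_ {dim}) using () renaming (_∈?_ to _∈ₗ?_)

    chosenClass : ∀ {u v} → Violated u v → ∀ ws → ∃ (ChosenClass ws)
    chosenClass viol ws with anySubset? (SplittableIn? ws)
    ... | yes found with F , max ← largest (SplittableIn? ws) found = F , inj₁ max
    ... | no ∄ with j , 2≤ ← splittable viol
      with F , max ← largest Splittable? (block P j , (j , refl) , 2≤)
      = F , inj₂ ((λ F′ s → ∄ (F′ , s)) , max)

    chosenClass-splittable : ∀ {ws F} → ChosenClass ws F → Splittable F
    chosenClass-splittable (inj₁ ((j , eq , 2≤ , _) , _)) = (j , eq) , 2≤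
    chosenClass-splittable (inj₂ (_ , s , _))             = s

    split-splittable : ∀ {F e} → Splittable F → e ∈ F → ∃[ P′ ] Splits e P P′
    split-splittable {e = e} ((j , refl) , 2≤) e∈F =
      split P e (subst (λ j → 2 ≤ ∣ block P j ∣) (sym (to (∈-block P j e) e∈F)) 2≤)

    repair-progress : dim ≤ n ∸ 1 → (∃[ u ] ∃[ v ] Violated u v) → ∃[ s ] repairing P ⟶ s
    repair-progress k≤kmax violated =
      let u , v , worst      = worstPair violated
          -- The shortest walk behind the table entry, read as a list of generators, is the geodesic
          -- word.
          (w , w≡c) , _      = proj₁ (proj₂ (proj₂ (dist-λ u v)))
          ws , all , sum , l = walk⇒word w
          F , chosen         = chosenClass (proj₁ worst) ws
          F-splittable       = chosenClass-splittable chosen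
          e , e∈F            = ∣∣≥1⇒nonempty (ℕ.<⇒≤ (proj₂ F-splittable))
          P′ , splits        = split-splittable F-splittable e∈F
      in repairing P′ , repair Q k≤kmax isDiameter spec worst
           (all , trans sum (⊕-identityˡ _) , trans l w≡c) chosen e∈F splits

    progress : dim ≤ n ∸ 1 → ∃[ s ] repairing P ⟶ s
    progress k≤kmax with any? (λ u → any? λ v → Violated? u v)
    ... | no ∄         = _ , accept Q k≤kmax isDiameter spec λ u v viol → ∄ (u , v , viol)
    ... | yes violated = repair-progress k≤kmax violated

  -- Termination and correctness of all runs

  Post : ∀ {k} → (Fin n → ℤ₂^ k) → Pred (ℤ₂^ k) 0ℓ → Set
  Post {k} label S = IsometricEmbedding G label S × k ≤ n ∸ 1

  naive-isometric : (Q : QuotientLabeling G root (singletons m)) →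
                    IsometricEmbedding G (QuotientLabeling.label Q) (QuotientLabeling.S Q)
  naive-isometric Q u v = δ u v , δ-isDist u v , Singleton.IsDist-label connected id Q (δ-isDist u v)

  repairing-progress : ∀ {t} (P : Partition m t) → ∃[ s ] repairing P ⟶ s
  repairing-progress {t} P = advance (labeling P connected)
    where
    advance : QuotientLabeling G root P → ∃[ s ] repairing P ⟶ s
    advance Q with n ∸ 1 ℕ.<? QuotientLabeling.k Q | diameter root
    ... | yes k>kmax | _ = _ , cap Q k>kmax (labeling (singletons m) connected)
    ... | no  k≯kmax | D , isDiameter =
      Repairing.progress Q isDiameter (proj₂ ∘ truncatedDist D) (ℕ.≮⇒≥ k≯kmax)
      where open CayleyDistance (Properties.S? connected Q)

  -- A split trades one unit of fuel for one class, which preserves the inequality; with the fuel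
  -- exhausted there would be more classes than edges.
  repairing-terminates : ∀ fuel {t} (P : Partition m t) → m < t + fuel →
                         TerminatesWith Post (repairing P)
  repairing-terminates zero {t} P m<t =
    contradiction (surjective⇒≤ (surjective P)) (ℕ.<⇒≱ (subst (m <_) (ℕ.+-identityʳ t) m<t))
  repairing-terminates (suc fuel) {t} P m<t = next (repairing-progress P) step
    where
    step : ∀ s → repairing P ⟶ s → TerminatesWith Post s
    step _ (cap Q _ naive) = done (naive-isometric naive , naive-dim G root connected naive)
    step _ (accept Q k≤kmax isDiameter spec unviolated) =
      done (Repairing.accepted-isometric Q isDiameter spec unviolated , k≤kmax)
    step _ (repair {P′ = P′} Q _ _ _ _ _ _ _ _) =
      repairing-terminates fuel P′ (subst (m <_) (ℕ.+-suc t fuel) m<t)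

  building-terminates : ∀ R → Acc _⊂_ R → ∀ Fs → PartialPartition R Fs →
                        TerminatesWith Post (building R Fs)
  building-terminates R (acc rec) Fs inv = next progress step
    where
    progress : ∃[ s ] building R Fs ⟶ s
    progress with nonempty? R
    ... | no empty = let P , eq = partial⇒partition empty inv in repairing P , start {P = P} empty eq
    ... | yes ne   = let C , largestC = largestComponent ne
                         K , nextC    = nextClass C
                     in building (R ─ K) (K ∷ Fs) , take largestC nextC
    step : ∀ s → building R Fs ⟶ s → TerminatesWith Post s
    step _ (take {C = C} {K} (isComp , _) nextC) =
      building-terminates (R ─ K) (rec smaller) (K ∷ Fs) (partial-∷ K⊆R K-nonempty inv)
      where
      K⊆R : K ⊆ R
      K⊆R = component⊆ isComp ∘ nextClass-⊆ nextC
      K-nonempty = nextClass-nonempty (component-nonempty isComp) nextC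
      smaller : R ─ K ⊂ R
      smaller = let e , e∈K = K-nonempty in p∩q≢∅⇒p─q⊂p R K (e , x∈p∩q⁺ (K⊆R e∈K , e∈K))
    -- Fuel `suc m` suffices whatever number of classes the clique phase has produced.
    step _ (start {P = P} _ _) = repairing-terminates (suc m) P (ℕ.m≤n+m (suc m) _)

theorem2p32 : ∀ {n : ℕ} (G : Graph n) → Connected G →
    (root : Fin n) (rule : Subset (Graph.m G) → CliqueRule) →
    let open Algorithm G (n ∸ 1) root rule in
    TerminatesWith (λ {k} label S → IsometricEmbedding G label S × k ≤ n ∸ 1) initial
theorem2p32 G connected root rule = building-terminates ⊤ (⊂-wellFounded ⊤) [] partial-[]
  where open Runs G connected root rule
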